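{- Let $G=(V,E)$ be a simple, undirected graph with $n=|V|$ vertices, $m=|E|$ edges, and at least one triangle. Then the triangle centrality $TC(v)$ can be computed for all vertices $v\in V$ on a CREW PRAM in $O(\log n)$ time using $O(m\sqrt m)$ processors.
   Context: For $v\in V$, $N(v)=\{u\mid (u,v)\in E\}$. A triangle is a complete subgraph on three vertices; $\triangle(v)$ is the number of triangles of $G$ containing $v$, and $\triangle(G)$ is the total number of triangles in $G$. The triangle neighborhood of $v$ is $N_\triangle(v)=\{u\in N(v)\mid N(u)\cap N(v)\neq\varnothing\}$, and $N_\triangle[v]=\{v\}\cup N_\triangle(v)$. The triangle centrality of $v$ is $$TC(v)=\frac{\frac13\sum_{u\in N_\triangle[v]}\triangle(u)+\sum_{w\in N(v)\setminus N_\triangle(v)}\triangle(w)}{\triangle(G)}.$$ In a PRAM (Parallel Random Access Machine), each processor can access any global memory location in unit time; processors can read from global memory, perform a computation, and write a result to global memory in a single clock cycle, and all processors execute these instructions at the same time. In a CREW (Concurrent Read Exclusive Write) PRAM, several processors may read the same memory location simultaneously, but writes to a memory location are restricted to one processor at a time. -}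

module Defs where

open import Data.Fin.Base as Fin using (Fin; toℕ)
import Data.Fin.Properties as Fin
open import Data.Integer.Base using (+_)
open import Data.List.Base using (List; []; _∷_; _++_; allFin; cartesianProduct; concat; filter; length; map; tabulate)
import Data.List.Base as List
open import Data.List.Relation.Binary.Permutation.Propositional using (_↭_)
open import Data.List.Scans.Base using (scanl)
open import Data.Maybe.Base using (Maybe; just; nothing)
open import Data.Nat.ListAction using (sum)
open import Data.Nat.Base as ℕ using (ℕ; zero; suc; _≡ᵇ_; _∸_; _<_)
open import Data.Bool.Base using (if_then_else_; _∧_)
open import Data.Product.Base using (_×_; _,_; proj₁; proj₂)
open import Data.Rational.Unnormalised.Base using (ℚᵘ; mkℚᵘ; _≃_; _/_; _+_; _*_; _÷_)
open import Level using (0ℓ)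
open import Relation.Binary.Core using (Rel)
open import Relation.Binary.Definitions as Binary using (Irreflexive; Symmetric)
open import Relation.Binary.PropositionalEquality.Core using (_≡_)
open import Relation.Nullary.Decidable using (_×-dec_; _⊎-dec_)
open import Relation.Unary using (Pred; Decidable; Satisfiable; _∩_; _∪_; ∁; ｛_｝)
open import Relation.Unary.Properties using (_∩?_; _∪?_; ∁?)

------------------------------------------------------------------------
-- Graphs and triangle centrality

record Graph (n : ℕ) : Set₁ where
  field
    E      : Rel (Fin n) 0ℓ
    E?     : Binary.Decidable E
    sym    : Symmetric E
    irrefl : Irreflexive _≡_ E

elements : ∀ {n} {P : Pred (Fin n) 0ℓ} → Decidable P → List (Fin n)
elements P? = filter P? (allFin _)

∑[_] : ∀ {n} {P : Pred (Fin n) 0ℓ} → Decidable P → (Fin n → ℕ) → ℕ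
∑[ P? ] f = sum (map f (elements P?))

module _ {n : ℕ} (G : Graph n) where
  open Graph G

  -- An undirected edge {u , v} is listed once, as the pair with u < v.
  edges : List (Fin n × Fin n)
  edges = filter (λ (u , v) → u Fin.<? v ×-dec E? u v)
                 (cartesianProduct (allFin n) (allFin n))

  ∣E∣ : ℕ
  ∣E∣ = length edges

  N : Fin n → Pred (Fin n) 0ℓ
  N v u = E v u

  N? : ∀ v → Decidable (N v)
  N? v u = E? v u

  -- A triangle {u , v , w} is listed once, as the triple with u < v < w.
  triangles : List (Fin n × Fin n × Fin n)
  triangles = filter
    (λ (u , v , w) → (u Fin.<? v ×-dec v Fin.<? w) ×-dec
                     (E? u v ×-dec E? v w ×-dec E? u w))
    (cartesianProduct (allFin n) (cartesianProduct (allFin n) (allFin n)))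

  △G : ℕ
  △G = length triangles

  △ : Fin n → ℕ
  △ x = length (filter
    (λ (u , v , w) → x Fin.≟ u ⊎-dec x Fin.≟ v ⊎-dec x Fin.≟ w) triangles)

  N△ : Fin n → Pred (Fin n) 0ℓ
  N△ v = N v ∩ λ u → Satisfiable (N u ∩ N v)

  N△? : ∀ v → Decidable (N△ v)
  N△? v = N? v ∩? λ u → Fin.any? (N? u ∩? N? v)

  N△[_] : Fin n → Pred (Fin n) 0ℓ
  N△[ v ] = ｛ v ｝ ∪ N△ v

  N△[_]? : ∀ v → Decidable N△[ v ]
  N△[ v ]? = (v Fin.≟_) ∪? N△? v

  TC : .{{_ : ℕ.NonZero △G}} → Fin n → ℚᵘ
  TC v = (+ 1 / 3 * (+ ∑[ N△[ v ]? ] △ / 1) + (+ ∑[ N? v ∩? ∁? (N△? v) ] △ / 1))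
           ÷ (+ △G / 1)

------------------------------------------------------------------------
-- The CREW PRAM

-- Registers are local to a processor.  Global memory consists of arrays
-- A₀, A₁, A₂, … of unbounded length; a program names an array by a literal.
-- Since a program mentions only k of them, for some constant k, placing
-- cell Aₐ[i] at address k * i + a gives the usual single address space.

Registers : Set
Registers = ℕ → ℕ

Cell : Set
Cell = ℕ × ℕ

Memory : Set
Memory = ℕ → ℕ → ℕ

-- There is deliberately no unit-cost multiplication or left shift: the
-- instructions below increase the largest value present by at most a constant
-- factor (depending on the program), so that in O(log n) steps all values stay
-- polynomial in n and the number of processors, i.e. words have O(log n) bits.

data Expr : Set where
  lit reg             : ℕ → Expr
  _⊕_ _⊖_ _div_ _mod_ : Expr → Expr → Expr

-- Truncated subtraction; quotient and remainder by 0 are 0.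
quot rem : ℕ → ℕ → ℕ
quot x zero    = 0
quot x (suc y) = x ℕ./ suc y
rem  x zero    = 0
rem  x (suc y) = x ℕ.% suc y

⟦_⟧ : Expr → Registers → ℕ
⟦ lit k ⟧   ρ = k
⟦ reg r ⟧   ρ = ρ r
⟦ d ⊕ e ⟧   ρ = ⟦ d ⟧ ρ ℕ.+ ⟦ e ⟧ ρ
⟦ d ⊖ e ⟧   ρ = ⟦ d ⟧ ρ ∸ ⟦ e ⟧ ρ
⟦ d div e ⟧ ρ = quot (⟦ d ⟧ ρ) (⟦ e ⟧ ρ)
⟦ d mod e ⟧ ρ = rem (⟦ d ⟧ ρ) (⟦ e ⟧ ρ)

data Instruction : Set

Program : Set
Program = List Instruction

data Instruction where
  set   : (r : ℕ) (e : Expr) → Instruction          -- r := e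
  load  : (r a : ℕ) (i : Expr) → Instruction        -- r := Aₐ[i]
  store : (a : ℕ) (i e : Expr) → Instruction        -- Aₐ[i] := e
  cond  : (e : Expr) (P Q : Program) → Instruction  -- if e ≠ 0 then P else Q
  while : (e : Expr) (P : Program) → Instruction    -- while e ≠ 0 do P

-- Control is per processor: `code` is what remains to be executed.
record Processor : Set where
  constructor processor
  field
    code : Program
    regs : Registers
open Processor public

_[_≔_] : Registers → ℕ → ℕ → Registers
(ρ [ r ≔ x ]) s = if s ≡ᵇ r then x else ρ s

Write : Set
Write = Cell × ℕ

branch : ℕ → Program → Program → Program
branch zero    P Q = Q
branch (suc _) P Q = P

-- One clock cycle of one processor: its new state and its write request.
-- A test (of `cond`, or each one of `while`) takes a cycle of its own.
cycle : Memory → Processor → Processor × Maybe Write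
cycle M (processor []               ρ) = processor [] ρ , nothing
cycle M (processor (set r e ∷ R)    ρ) = processor R (ρ [ r ≔ ⟦ e ⟧ ρ ]) , nothing
cycle M (processor (load r a i ∷ R) ρ) = processor R (ρ [ r ≔ M a (⟦ i ⟧ ρ) ]) , nothing
cycle M (processor (store a i e ∷ R) ρ) = processor R ρ , just ((a , ⟦ i ⟧ ρ) , ⟦ e ⟧ ρ)
cycle M (processor (cond e P Q ∷ R) ρ) = processor (branch (⟦ e ⟧ ρ) P Q ++ R) ρ , nothing
cycle M (processor (while e P ∷ R)  ρ) =
  processor (branch (⟦ e ⟧ ρ) (P ++ while e P ∷ R) R) ρ , nothing

record Configuration (p : ℕ) : Set where
  constructor configuration
  field
    procs  : Fin p → Processor
    memory : Memory
open Configuration public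

writes : ∀ {p} → Configuration p → Fin p → Maybe Write
writes c i = proj₂ (cycle (memory c) (procs c i))

commit : Maybe Write → Memory → Memory
commit nothing              M = M
commit (just ((a , i) , x)) M b j = if (b ≡ᵇ a) ∧ (j ≡ᵇ i) then x else M b j

-- Synchronous step: all reads see the memory before any write of this cycle.
-- The order in which writes are committed is irrelevant under `Exclusive`.
step : ∀ {p} → Configuration p → Configuration p
step c = configuration
  (λ i → proj₁ (cycle (memory c) (procs c i)))
  (List.foldr commit (memory c) (tabulate (writes c)))

run : ∀ {p} → ℕ → Configuration p → Configuration p
run zero    c = c
run (suc t) c = step (run t c)

Exclusive : ∀ {p} → Configuration p → Set
Exclusive c = ∀ i j cell x y →
  writes c i ≡ just (cell , x) → writes c j ≡ just (cell , y) → i ≡ j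

Halted : ∀ {p} → Configuration p → Set
Halted c = ∀ i → code (procs c i) ≡ []

initialRegisters : ℕ → Registers
initialRegisters i zero    = i
initialRegisters i (suc _) = 0

-- Every processor runs the same program and finds its index in register 0.
start : (P : Program) (p : ℕ) → Memory → Configuration p
start P p M = configuration
  (λ i → processor P (initialRegisters (toℕ i))) M

record CREW-Computes (P : Program) (p t : ℕ) (M : Memory) (Post : Memory → Set) : Set where
  field
    exclusive : ∀ s → s < t → Exclusive (run s (start P p M))
    halted    : Halted (run t (start P p M))
    result    : Post (memory (run t (start P p M)))

------------------------------------------------------------------------
-- Input and output

-- Adjacency lists, in arbitrary order.
record AdjacencyLists {n : ℕ} (G : Graph n) : Set where
  field
    adj     : Fin n → List (Fin n)
    correct : ∀ v → adj v ↭ elements (N? G v)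

contents : List ℕ → ℕ → ℕ
contents []       _       = 0
contents (x ∷ xs) zero    = x
contents (x ∷ xs) (suc i) = contents xs i

-- A₀ = [n , m].  A₂ is the concatenation of the adjacency lists of
-- 0, …, n - 1, that of v occupying positions A₁[v], …, A₁[v + 1] - 1.
-- Every other cell is 0.
input : ∀ {n} (G : Graph n) → AdjacencyLists G → Memory
input {n} G L 0 = contents (n ∷ ∣E∣ G ∷ [])
input     G L 1 = contents (scanl ℕ._+_ 0 (tabulate (λ v → length (AdjacencyLists.adj L v))))
input     G L 2 = contents (map toℕ (concat (tabulate (AdjacencyLists.adj L))))
input     G L _ = λ _ → 0

-- The output for v is the fraction A₃[v] / (1 + A₄[v]).
output : Memory → ℕ → ℚᵘ
output M v = mkℚᵘ (+ M 3 v) (M 4 v)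

HoldsTC : ∀ {n} (G : Graph n) .{{_ : ℕ.NonZero (△G G)}} → Memory → Set
HoldsTC G M = ∀ v → output M (toℕ v) ≃ TC G v

{-# OPTIONS --safe #-}

-- Write an arc for each ordered pair of adjacent vertices, and let c (v , u) be
-- the number of common neighbours of v and u.  The sum of c over the arcs
-- leaving v is 2 △(v), the sum over all arcs is 6 △(G), and u ∈ N△(v) exactly
-- if c (v , u) ≠ 0; hence TC(v) is determined by sums over the arcs leaving v,
-- which are differences of prefix sums.
--
-- The number c (v , u) is found by testing, for all neighbours w of the endpoint
-- of smaller degree, whether w is adjacent to the other endpoint.  There are at
-- most Σ min (deg v , deg u) = O(m √m) such tests, and each gets a processor of
-- its own, which finds its arc by binary search in the prefix sums of
-- min (deg v , deg u).  A test is a lookup in an adjacency matrix with rows of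
-- length 2 ^ k ≥ n, as multiplication by 2 ^ k is repeated doubling; the matrix
-- need not be cleared because memory is initially 0.
--
-- All processors execute the same instructions in lockstep.
module Submission where

open import Defs
open import Data.Nat using (ℕ; _*_; _^_; _≤_; NonZero)
open import Data.Nat.Logarithm using (⌊log₂_⌋)
open import Data.Product using (Σ-syntax; ∃-syntax; _×_)

open import Data.Bool.Base using (true; false; if_then_else_)
open import Data.Bool.Properties using (T-≡)
open import Data.Fin.Base as Fin using (Fin; zero; suc; toℕ; fromℕ<)
import Data.Fin.Properties as Fin
open import Data.Integer.Base as ℤ using () renaming (+_ to int)
import Data.Integer.Properties as ℤ
import Data.Integer.Tactic.RingSolver as ℤ
open import Data.List.Base using (List; []; _∷_; _++_; foldr; tabulate; map; filter; length; cartesianProduct; allFin; concat; lookup)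
open import Data.List.Membership.Propositional using (_∈_)
open import Data.List.Membership.Propositional.Properties using (∈-filter⁺; ∈-filter⁻; ∈-allFin; ∈-lookup)
open import Data.List.Properties using (tabulate-cong; ++-assoc; ++-identityʳ; map-++; map-∘)
open import Data.List.Relation.Binary.Permutation.Propositional using (↭-sym; ↭⇒↭ₛ)
open import Data.List.Relation.Binary.Permutation.Propositional.Properties using (map⁺; ∈-resp-↭)
import Data.List.Relation.Binary.Permutation.Setoid.Properties as Permutation
import Data.List.Relation.Unary.All as All
open import Data.List.Relation.Unary.AllPairs using (_∷_)
open import Data.List.Relation.Unary.Any using (index)
open import Data.List.Relation.Unary.Any.Properties using (lookup-index)
open import Data.List.Relation.Unary.Unique.Propositional using (Unique)
import Data.List.Relation.Unary.Unique.Propositional.Properties as Unique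
open import Data.List.Scans.Base using (scanl)
open import Data.Maybe.Base using (Maybe; just; nothing)
open import Data.Maybe.Properties using (just-injective)
open import Data.Nat hiding (_/_; _%_)
open import Data.Nat.DivMod using (_%_; n/1≡n; m*n/n≡m; 0/n≡0; [m+kn]%n≡m%n; m<n⇒m%n≡m)
import Data.Nat.ListAction as List
open import Data.Nat.ListAction.Properties using (sum-++; sum-↭)
open import Data.Nat.Logarithm using (⌊log₂⌋-mono-≤; ⌊log₂[2^n]⌋≡n)
open import Data.Nat.Properties
open import Algebra.Properties.Semiring.Sum +-*-semiring
  using (sum; sum-cong-≗; ∑-distrib-+; ∑-comm; *-distribˡ-sum; *-distribʳ-sum; sum-replicate-zero)
open import Data.Nat.Tactic.RingSolver using (solve-∀)
open import Data.Product using (_,_; proj₁; proj₂)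
open import Data.Rational.Unnormalised.Base as ℚ using (mkℚᵘ; *≡*; _≃_)
open import Data.Sum.Base using (_⊎_; inj₁; inj₂)
open import Function.Base using (_∘_; id; case_of_)
open import Function.Bundles using (Equivalence)
open import Level using (0ℓ)
open import Relation.Binary.Definitions using (tri<; tri≈; tri>)
open import Relation.Binary.PropositionalEquality
open import Relation.Nullary using (¬_; Dec; yes; no; contradiction)
open import Relation.Nullary.Decidable using (does; _×-dec_; _⊎-dec_; ¬?)
open import Relation.Unary using (Pred; Decidable; Satisfiable; _∩_)
open import Relation.Unary.Properties using (_∩?_; ∁?)

-- Lockstep execution

-- Lockstep is what makes exclusivity provable: if all processors store in the same cycle,
-- exclusiveness is injectivity of one function from processors to cells. The price is that each
-- `while` test must have the same outcome for all processors. Choices that depend on the data are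
-- therefore made by arithmetic: dividing by a truth value multiplies by it, as a quotient by 0 is
-- 0. The only `cond` is the one in `guardedStore`.
--
-- With D(v) = 2 △(v), six times the numerator of TC(v) is D(v) plus, for every neighbour u, D(u) if
-- c (v , u) ≠ 0 and 3 D(u) otherwise; six times the denominator is the sum of c over all arcs. Thus
-- the output needs no division and no product of two data values.
--
-- Processors to which no arc or test belongs run along with unspecified values, so assertions about
-- data are restricted to indices below the relevant length. Their writes go to cells that no other
-- processor writes in that cycle.

Assertion : ℕ → Set₁
Assertion p = (Fin p → Registers) → Memory → Set

record At {p} (R : Fin p → Program) (ρ : Fin p → Registers) (M : Memory) (c : Configuration p) : Set where
  constructor at
  field
    at-procs  : ∀ i → procs c i ≡ processor (R i) (ρ i)
    at-memory : memory c ≡ M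

-- `T` is only an upper bound because the loops stop at a moment that depends on the data; `time` is
-- nevertheless common to all processors.
record Reaches {p} (R : Program) (T : ℕ) (Post : Assertion p) (c : Configuration p) : Set where
  field
    time      : ℕ
    bounded   : time ≤ T
    exclusive : ∀ s → s < time → Exclusive (run s c)
    ρ′        : Fin p → Registers
    M′        : Memory
    arrived   : At (λ _ → R) ρ′ M′ (run time c)
    post      : Post ρ′ M′

-- A Hoare triple: started with each processor i about to execute P i, the
-- machine gets within T cycles, with exclusive writes, to a state satisfying
-- Post in which all processors finish at the same moment.
record Execs {p} (P : Fin p → Program) (T : ℕ) (ρ : Fin p → Registers) (M : Memory)
             (Post : Assertion p) : Set where
  field
    reach : ∀ R c → At (λ i → P i ++ R) ρ M c → Reaches R T Post c
open Execs

Exec : ∀ {p} → Program → ℕ → (Fin p → Registers) → Memory → Assertion p → Set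
Exec P = Execs (λ _ → P)

-- `run` adds cycles at the end, whereas the rules for instructions peel them off at the front.
run-step : ∀ {p} t (c : Configuration p) → run t (step c) ≡ run (suc t) c
run-step zero    c = refl
run-step (suc t) c = cong step (run-step t c)

run-+ : ∀ {p} s t (c : Configuration p) → run s (run t c) ≡ run (s + t) c
run-+ zero    t c = refl
run-+ (suc s) t c = cong step (run-+ s t c)

module _ {p : ℕ} where

  private variable
    P Q R : Program
    T T′ : ℕ
    ρ : Fin p → Registers
    M : Memory
    Post Mid : Assertion p

  exec-[] : Post ρ M → Exec [] T ρ M Post
  exec-[] post .reach R c a = record
    { time = 0 ; bounded = z≤n ; exclusive = λ _ () ; arrived = a ; post = post }

  exec-weaken : T ≤ T′ → (∀ ρ M → Post ρ M → Mid ρ M) → Exec P T ρ M Post → Exec P T′ ρ M Mid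
  exec-weaken T≤T′ f x .reach R c a = record
    { time = time ; bounded = ≤-trans bounded T≤T′ ; exclusive = exclusive
    ; arrived = arrived ; post = f _ _ post }
    where open Reaches (x .reach R c a)

  reaches-trans : ∀ {c : Configuration p} (r : Reaches R T Mid c) →
                  Reaches Q T′ Post (run (Reaches.time r) c) → Reaches Q (T + T′) Post c
  reaches-trans {c = c} r r′ = record
    { time    = r′.time + r.time
    ; bounded = ≤-trans (≤-reflexive (+-comm r′.time _)) (+-mono-≤ r.bounded r′.bounded)
    ; exclusive    = exclusive
    ; arrived = subst (At _ _ _) (run-+ r′.time r.time c) r′.arrived
    ; post    = r′.post
    }
    where
    module r  = Reaches r
    module r′ = Reaches r′
    exclusive : ∀ s → s < r′.time + r.time → Exclusive (run s c)
    exclusive s s< with s <? r.time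
    ... | yes s<t = r.exclusive s s<t
    ... | no  s≮t = subst Exclusive
      (trans (run-+ (s ∸ r.time) r.time c) (cong (λ x → run x c) (m∸n+n≡m (≮⇒≥ s≮t))))
      (r′.exclusive (s ∸ r.time) (subst (s ∸ r.time <_) (m+n∸n≡m r′.time r.time)
        (∸-monoˡ-< s< (≮⇒≥ s≮t))))

  exec-++ : ∀ P → Exec P T ρ M Mid → (∀ ρ M → Mid ρ M → Exec Q T′ ρ M Post) →
            Exec (P ++ Q) (T + T′) ρ M Post
  exec-++ {Q = Q} P x f .reach R c a = reaches-trans r (f _ _ r.post .reach R _ r.arrived)
    where
    r = x .reach (Q ++ R) c (subst (λ P → At (λ _ → P) _ _ c) (++-assoc P Q R) a)
    module r = Reaches r

  infixr 4 _>>=_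
  _>>=_ : Exec P T ρ M Mid → (∀ ρ M → Mid ρ M → Exec Q T′ ρ M Post) →
          Exec (P ++ Q) (T + T′) ρ M Post
  _>>=_ = exec-++ _

  one-step : ∀ {c : Configuration p} → Exclusive c → Reaches R T Post (step c) → Reaches R (suc T) Post c
  one-step {c = c} e r = record
    { time      = suc r.time
    ; bounded   = s≤s r.bounded
    ; exclusive = λ { zero _ → e
                    ; (suc s) (s≤s s<t) → subst Exclusive (run-step s c) (r.exclusive s s<t) }
    ; arrived   = subst (At _ _ _) (run-step r.time c) r.arrived
    ; post      = r.post
    }
    where module r = Reaches r

  commit-nothing : ∀ {q} (w : Fin q → Maybe Write) → (∀ i → w i ≡ nothing) →
                   foldr commit M (tabulate w) ≡ M
  commit-nothing {q = zero}  w h = refl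
  commit-nothing {q = suc q} w h rewrite h zero = commit-nothing (w ∘ suc) (h ∘ suc)

  -- The rule for a cycle without writes. The new code is compared with `Q i ++ R` by a separate
  -- equation, since `branch` on an unknown value and reassociation of `++` do not reduce, while the
  -- cycle itself does. `Q` may differ between processors so that a `cond` can split them for one
  -- cycle.
  exec-local : ∀ {P} {Q : Fin p → Program} {ρ′ : Fin p → Registers} →
    (∀ R i → ∃[ Q′ ] Q′ ≡ Q i ++ R × cycle M (processor (P ++ R) (ρ i)) ≡ (processor Q′ (ρ′ i) , nothing)) →
    Execs Q T ρ′ M Post → Exec P (suc T) ρ M Post
  exec-local {M = M} {ρ = ρ} {P = P} {Q} {ρ′} local x .reach R c (at ps refl) =
    one-step excl (x .reach R (step c) a)
    where
    cyc : ∀ i → cycle (memory c) (procs c i) ≡ (processor (Q i ++ R) (ρ′ i) , nothing)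
    cyc i with local R i
    ... | _ , refl , eq = trans (cong (cycle (memory c)) (ps i)) eq
    excl : Exclusive c
    excl i j cell u v wi _ = case trans (sym wi) (cong proj₂ (cyc i)) of λ ()
    a : At (λ i → Q i ++ R) ρ′ (memory c) (step c)
    a = at (cong proj₁ ∘ cyc) (commit-nothing (writes c) (cong proj₂ ∘ cyc))

  exec-set : ∀ {r e} → Exec P T (λ i → ρ i [ r ≔ ⟦ e ⟧ (ρ i) ]) M Post →
             Exec (set r e ∷ P) (suc T) ρ M Post
  exec-set {P = P} = exec-local λ R i → P ++ R , refl , refl

  exec-load : ∀ {r a e} → Exec P T (λ i → ρ i [ r ≔ M a (⟦ e ⟧ (ρ i)) ]) M Post →
              Exec (load r a e ∷ P) (suc T) ρ M Post
  exec-load {P = P} = exec-local λ R i → P ++ R , refl , refl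

  branch-≡0 : ∀ {k} → k ≡ 0 → branch k P Q ≡ Q
  branch-≡0 refl = refl

  branch-≢0 : ∀ {k} → k ≢ 0 → branch k P Q ≡ P
  branch-≢0 {k = zero}  k≢0 = contradiction refl k≢0
  branch-≢0 {k = suc _} _   = refl

  exec-while-exit : ∀ {e} → (∀ i → ⟦ e ⟧ (ρ i) ≡ 0) → Post ρ M →
                    Exec (while e P ∷ []) 1 ρ M Post
  exec-while-exit {ρ = ρ} {P = P} {e} g post = exec-local {Q = λ _ → []}
    (λ R i → branch (⟦ e ⟧ (ρ i)) (P ++ while e P ∷ R) R , branch-≡0 (g i) , refl)
    (exec-[] post)

  exec-while-step : ∀ {e} → (∀ i → ⟦ e ⟧ (ρ i) ≢ 0) → Exec P T ρ M Mid →
                    (∀ ρ M → Mid ρ M → Exec (while e P ∷ []) T′ ρ M Post) →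
                    Exec (while e P ∷ []) (suc (T + T′)) ρ M Post
  exec-while-step {ρ = ρ} {P = P} {e = e} g x f = exec-local {Q = λ _ → P ++ while e P ∷ []}
    (λ R i → branch (⟦ e ⟧ (ρ i)) (P ++ while e P ∷ R) R
           , trans (branch-≢0 (g i)) (sym (++-assoc P (while e P ∷ []) R)) , refl)
    (x >>= f)

  -- The index of `Inv` bounds the remaining iterations. The two alternatives of `body` force the
  -- test to come out alike everywhere, which preserves lockstep. The loop may end early, hence the
  -- existential `j` at exit.
  exec-loop : ∀ {e} (Inv : ℕ → Assertion p) →
    (∀ k ρ M → Inv k ρ M → (∀ i → ⟦ e ⟧ (ρ i) ≡ 0) ⊎
      ∃[ k′ ] k ≡ suc k′ × (∀ i → ⟦ e ⟧ (ρ i) ≢ 0) × Exec P T ρ M (Inv k′)) →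
    ∀ k {ρ M} → Inv k ρ M → Exec (while e P ∷ []) (suc (k * suc T)) ρ M
      (λ ρ M → (∃[ j ] Inv j ρ M) × ∀ i → ⟦ e ⟧ (ρ i) ≡ 0)
  exec-loop {P = P} {T = T} {e = e} Inv body k {ρ} {M} inv with body k ρ M inv
  ... | inj₁ g = exec-weaken (s≤s z≤n) (λ _ _ → id) (exec-while-exit {P = P} {e = e} g ((k , inv) , g))
  ... | inj₂ (k′ , refl , g , x) = exec-weaken
    (≤-reflexive (cong suc (+-suc T (k′ * suc T)))) (λ _ _ → id)
    (exec-while-step g x λ ρ M → exec-loop Inv body k′)

  record Written (M : Memory) (cell : Fin p → Cell) (val : Fin p → ℕ) (M′ : Memory) : Set where
    field
      hit  : ∀ i → M′ (proj₁ (cell i)) (proj₂ (cell i)) ≡ val i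
      miss : ∀ a j → (∀ i → cell i ≢ (a , j)) → M′ a j ≡ M a j

-- Simultaneous writes to distinct cells

≡ᵇ-refl : ∀ n → (n ≡ᵇ n) ≡ true
≡ᵇ-refl n = Equivalence.to T-≡ (≡⇒≡ᵇ n n refl)

commit-hit : ∀ a i x M → commit (just ((a , i) , x)) M a i ≡ x
commit-hit a i x M rewrite ≡ᵇ-refl a | ≡ᵇ-refl i = refl

commit-miss : ∀ a i x M b j → (a , i) ≢ (b , j) → commit (just ((a , i) , x)) M b j ≡ M b j
commit-miss a i x M b j ne with b ≡ᵇ a in eqa | j ≡ᵇ i in eqi
... | false | _     = refl
... | true  | false = refl
... | true  | true  = contradiction
  (cong₂ _,_ (sym (≡ᵇ⇒≡ b a (Equivalence.from T-≡ eqa))) (sym (≡ᵇ⇒≡ j i (Equivalence.from T-≡ eqi)))) ne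

-- `foldr` commits the write of processor 0 last, so the values of the others survive because their
-- cells differ from its cell.
commit-all : ∀ {p} M (cell : Fin p → Cell) (val : Fin p → ℕ) →
             (∀ i j → cell i ≡ cell j → i ≡ j) →
             Written M cell val (foldr commit M (tabulate λ i → just (cell i , val i)))
commit-all {zero} M cell val inj = record { hit = λ () ; miss = λ _ _ _ → refl }
commit-all {suc p} M cell val inj = record { hit = hit ; miss = miss }
  where
  M₁ = foldr commit M (tabulate λ i → just (cell (suc i) , val (suc i)))
  rest : Written M (cell ∘ suc) (val ∘ suc) M₁
  rest = commit-all M (cell ∘ suc) (val ∘ suc) λ i j eq → Fin.suc-injective (inj _ _ eq)
  hit : ∀ i → commit (just (cell zero , val zero)) M₁ (proj₁ (cell i)) (proj₂ (cell i)) ≡ val i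
  hit zero    = commit-hit _ _ _ M₁
  hit (suc i) = trans (commit-miss _ _ _ M₁ _ _ λ eq → case inj _ _ eq of λ ())
                      (Written.hit rest i)
  miss : ∀ a j → (∀ i → cell i ≢ (a , j)) → commit (just (cell zero , val zero)) M₁ a j ≡ M a j
  miss a j ne = trans (commit-miss _ _ _ M₁ a j (ne zero)) (Written.miss rest a j (ne ∘ suc))

-- The processors that fail the test write as well, each to a cell of its own
-- in a scratch array, so that both branches take one cycle.
guardedStore : Expr → (a : ℕ) → Expr → Expr → (s : ℕ) → Expr → Instruction
guardedStore g a e e′ s f = cond g (store a e e′ ∷ []) (store s f (lit 0) ∷ [])

module _ {p : ℕ} where

  private variable
    P Q : Program
    T : ℕ
    ρ : Fin p → Registers
    M : Memory
    Post : Assertion p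

  exec-writes : ∀ {P : Fin p → Program} (cell : Fin p → Cell) (val : Fin p → ℕ) →
    (∀ R i → cycle M (processor (P i ++ R) (ρ i)) ≡ (processor (Q ++ R) (ρ i) , just (cell i , val i))) →
    (∀ i j → cell i ≡ cell j → i ≡ j) →
    (∀ M′ → Written M cell val M′ → Exec Q T ρ M′ Post) →
    Execs P (suc T) ρ M Post
  exec-writes {M = M} {ρ = ρ} {Q = Q} cell val cyc inj x .reach R c (at ps refl) =
    one-step excl (x _ (commit-all M cell val inj) .reach R (step c) a)
    where
    cyc′ : ∀ i → cycle (memory c) (procs c i) ≡ (processor (Q ++ R) (ρ i) , just (cell i , val i))
    cyc′ i = trans (cong (cycle (memory c)) (ps i)) (cyc R i)
    excl : Exclusive c
    excl i j _ u v wi wj = inj i j (trans (cell≡ i wi) (sym (cell≡ j wj)))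
      where
      cell≡ : ∀ i {w} → writes c i ≡ just w → cell i ≡ proj₁ w
      cell≡ i wi = cong proj₁ (just-injective (trans (sym (cong proj₂ (cyc′ i))) wi))
    a : At (λ _ → Q ++ R) ρ (foldr commit (memory c) (tabulate λ i → just (cell i , val i))) (step c)
    a = at (cong proj₁ ∘ cyc′)
           (cong (foldr commit (memory c)) (tabulate-cong (cong proj₂ ∘ cyc′)))

  exec-store : ∀ {a e e′} →
    (∀ i j → ⟦ e ⟧ (ρ i) ≡ ⟦ e ⟧ (ρ j) → i ≡ j) →
    (∀ M′ → Written M (λ i → a , ⟦ e ⟧ (ρ i)) (λ i → ⟦ e′ ⟧ (ρ i)) M′ → Exec P T ρ M′ Post) →
    Exec (store a e e′ ∷ P) (suc T) ρ M Post
  exec-store inj = exec-writes _ _ (λ R i → refl) (λ i j eq → inj i j (cong proj₂ eq))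

  -- Two processors that pass the test are separated by `e`, two that fail by `f`, and a mixed pair
  -- by `s ≢ a`. Nothing is recorded about the scratch array afterwards.
  exec-guardedStore : ∀ {g a e e′ s f} →
    (∀ i j → ⟦ g ⟧ (ρ i) ≢ 0 → ⟦ g ⟧ (ρ j) ≢ 0 → ⟦ e ⟧ (ρ i) ≡ ⟦ e ⟧ (ρ j) → i ≡ j) →
    (∀ i j → ⟦ f ⟧ (ρ i) ≡ ⟦ f ⟧ (ρ j) → i ≡ j) →
    s ≢ a →
    (∀ M′ →
      (∀ i → ⟦ g ⟧ (ρ i) ≢ 0 → M′ a (⟦ e ⟧ (ρ i)) ≡ ⟦ e′ ⟧ (ρ i)) →
      (∀ k → (∀ i → ⟦ g ⟧ (ρ i) ≢ 0 → ⟦ e ⟧ (ρ i) ≢ k) → M′ a k ≡ M a k) →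
      (∀ b → b ≢ a → b ≢ s → ∀ k → M′ b k ≡ M b k) →
      Exec P T ρ M′ Post) →
    Exec (guardedStore g a e e′ s f ∷ P) (suc (suc T)) ρ M Post
  exec-guardedStore {ρ = ρ} {M = M} {P = P} {g = g} {a} {e} {e′} {s} {f} inj injᶠ s≢a x =
    exec-local {Q = λ i → branch (test i) (store a e e′ ∷ []) (store s f (lit 0) ∷ []) ++ P}
      (λ R i → _ , sym (++-assoc (branch (test i) _ _) P R) , refl)
      (exec-writes cell val
        (λ R i → cyc R i (test i))
        (λ i j → cell-inj i j (test i) (test j) refl refl)
        (λ M′ w → let open Written w in x M′
          (λ i g≢0 → subst (λ c → M′ (proj₁ c) (proj₂ c) ≡ _) (cell≡ i g≢0) (trans (hit i) (val≡ i g≢0)))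
          (λ k ne → miss a k λ i → miss-cell k i (test i) (ne i))
          (λ b b≢a b≢s k → miss b k λ i → miss-array b k b≢a b≢s i (test i))))
    where
    test : Fin p → ℕ
    test i = ⟦ g ⟧ (ρ i)
    -- The outcome of the test is a separate argument, so that cases on it can be distinguished by
    -- pattern matching.
    cellOf : Fin p → ℕ → Cell
    cellOf i zero    = s , ⟦ f ⟧ (ρ i)
    cellOf i (suc _) = a , ⟦ e ⟧ (ρ i)
    valOf : Fin p → ℕ → ℕ
    valOf i zero    = 0
    valOf i (suc _) = ⟦ e′ ⟧ (ρ i)
    cell : Fin p → Cell
    cell i = cellOf i (test i)
    val : Fin p → ℕ
    val i = valOf i (test i)
    cyc : ∀ R i t → cycle M (processor ((branch t (store a e e′ ∷ []) (store s f (lit 0) ∷ []) ++ P) ++ R) (ρ i))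
                    ≡ (processor (P ++ R) (ρ i) , just (cellOf i t , valOf i t))
    cyc R i zero    = refl
    cyc R i (suc _) = refl
    cell-inj : ∀ i j t u → test i ≡ t → test j ≡ u → cellOf i t ≡ cellOf j u → i ≡ j
    cell-inj i j zero    zero    _ _ eq = injᶠ i j (cong proj₂ eq)
    cell-inj i j zero    (suc _) _ _ eq = contradiction (cong proj₁ eq) s≢a
    cell-inj i j (suc _) zero    _ _ eq = contradiction (sym (cong proj₁ eq)) s≢a
    cell-inj i j (suc _) (suc _) ti tj eq =
      inj i j (λ z → 1+n≢0 (trans (sym ti) z)) (λ z → 1+n≢0 (trans (sym tj) z)) (cong proj₂ eq)
    cell≡ : ∀ i → test i ≢ 0 → cell i ≡ (a , ⟦ e ⟧ (ρ i))
    cell≡ i g≢0 with test i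
    ... | zero  = contradiction refl g≢0
    ... | suc _ = refl
    val≡ : ∀ i → test i ≢ 0 → val i ≡ ⟦ e′ ⟧ (ρ i)
    val≡ i g≢0 with test i
    ... | zero  = contradiction refl g≢0
    ... | suc _ = refl
    miss-cell : ∀ k i t → (t ≢ 0 → ⟦ e ⟧ (ρ i) ≢ k) → cellOf i t ≢ (a , k)
    miss-cell k i zero    ne eq = s≢a (cong proj₁ eq)
    miss-cell k i (suc _) ne eq = ne (λ ()) (cong proj₂ eq)
    miss-array : ∀ b k → b ≢ a → b ≢ s → ∀ i t → cellOf i t ≢ (b , k)
    miss-array b k b≢a b≢s i zero    eq = b≢s (sym (cong proj₁ eq))
    miss-array b k b≢a b≢s i (suc _) eq = b≢a (sym (cong proj₁ eq))

exec-computes : ∀ {P p T M Post} {Q : Memory → Set} →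
  Exec {p} P T (λ i → initialRegisters (toℕ i)) M Post → (∀ ρ M → Post ρ M → Q M) →
  ∃[ t ] (t ≤ T × CREW-Computes P p t M Q)
exec-computes {P} {p} {M = M} {Q = Q} x f = time , bounded , record
  { exclusive = exclusive
  ; halted    = λ i → cong code (At.at-procs arrived i)
  ; result    = subst Q (sym (At.at-memory arrived)) (f _ _ post)
  }
  where open Reaches (x .reach [] (start P p M) (at (λ i → cong (λ P → processor P _) (sym (++-identityʳ P))) refl))

-- Building blocks: repeated doubling, binary search, prefix sums

2^1+n : ∀ k → 2 ^ k + 2 ^ k ≡ 2 ^ suc k
2^1+n k = cong (2 ^ k +_) (sym (+-identityʳ _))

-- Multiplies reg 2 and reg 3 by the least power of 2 that is at least reg 0.
doubling : Program
doubling = while (reg 0 ⊖ reg 1)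
  ( set 1 (reg 1 ⊕ reg 1)
  ∷ set 2 (reg 2 ⊕ reg 2)
  ∷ set 3 (reg 3 ⊕ reg 3)
  ∷ []) ∷ []

-- Untouched registers are written `4 + r` so that looking them up reduces past the updates of
-- registers 0 to 3; `frame` is then preserved by computation.
record Doubled {p} (lim b : ℕ) (ρ : Fin p → Registers) (M : Memory)
               (k : ℕ) (ρ′ : Fin p → Registers) (M′ : Memory) : Set where
  field
    k≤b     : k ≤ b
    memory≡ : M′ ≡ M
    limit   : ∀ i → ρ′ i 0 ≡ lim
    power   : ∀ i → ρ′ i 1 ≡ 2 ^ k
    scaled  : ∀ i r → r < 2 → ρ′ i (2 + r) ≡ ρ i (2 + r) * 2 ^ k
    frame   : ∀ i r → ρ′ i (4 + r) ≡ ρ i (4 + r)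

-- The exit test is a statement about all processors and says nothing if there are none; the given
-- element of `Fin p` turns it into `lim ≤ 2 ^ k`. The invariant keeps `k + j ≡ b`, so the bound
-- `lim ≤ 2 ^ b` stops the loop by the time no iteration is left.
exec-doubling : ∀ {p} lim b {ρ : Fin p → Registers} {M} → Fin p →
  (∀ i → ρ i 0 ≡ lim) → (∀ i → ρ i 1 ≡ 1) → lim ≤ 2 ^ b →
  Exec doubling (suc (b * 4)) ρ M
    (λ ρ′ M′ → ∃[ k ] lim ≤ 2 ^ k × Doubled lim b ρ M k ρ′ M′)
exec-doubling {p} lim b {ρ} {M} i₀ ρ0 ρ1 lim≤ = exec-weaken ≤-refl finish (exec-loop Inv body b
        (0 , refl , record
          { k≤b = z≤n ; memory≡ = refl ; limit = ρ0 ; power = ρ1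
          ; scaled = λ i r _ → sym (*-identityʳ _) ; frame = λ _ _ → refl }))
  where
  Inv : ℕ → Assertion p
  Inv j ρ′ M′ = ∃[ k ] k + j ≡ b × Doubled lim b ρ M k ρ′ M′
  finish : ∀ ρ′ M′ → (∃[ j ] Inv j ρ′ M′) × (∀ i → ρ′ i 0 ∸ ρ′ i 1 ≡ 0) →
           ∃[ k ] lim ≤ 2 ^ k × Doubled lim b ρ M k ρ′ M′
  finish ρ′ M′ ((_ , k , _ , d) , g) =
    k , m∸n≡0⇒m≤n (subst₂ (λ x y → x ∸ y ≡ 0) (limit i₀) (power i₀) (g i₀)) , d
    where open Doubled d
  body : ∀ j ρ′ M′ → Inv j ρ′ M′ → (∀ i → ρ′ i 0 ∸ ρ′ i 1 ≡ 0) ⊎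
         ∃[ j′ ] j ≡ suc j′ × (∀ i → ρ′ i 0 ∸ ρ′ i 1 ≢ 0) × Exec _ 3 ρ′ M′ (Inv j′)
  body j ρ′ M′ (k , k+j , d) with lim ≤? 2 ^ k
  ... | yes lim≤2^k = inj₁ λ i → trans (cong₂ _∸_ (limit i) (power i)) (m≤n⇒m∸n≡0 lim≤2^k)
    where open Doubled d
  body zero ρ′ M′ (k , k+j , d) | no lim≰ =
    contradiction (subst (λ k → lim ≤ 2 ^ k) (trans (sym k+j) (+-identityʳ k)) lim≤) lim≰
  body (suc j) ρ′ M′ (k , k+j , d) | no lim≰ = inj₂ (j , refl
    , (λ i g → lim≰ (m∸n≡0⇒m≤n (subst₂ (λ x y → x ∸ y ≡ 0) (limit i) (power i) g)))
    , exec-set (exec-set (exec-set (exec-[] (suc k , trans (sym (+-suc k j)) k+j , record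
        { k≤b = subst (suc k ≤_) k+j (subst (_≤ k + suc j) (+-comm k 1) (+-monoʳ-≤ k (s≤s z≤n)))
        ; memory≡ = memory≡ ; limit = limit
        ; power = λ i → trans (cong (λ x → x + x) (power i)) (2^1+n k)
        ; scaled = sc
        ; frame = frame })))))
    where
    open Doubled d
    dbl : ∀ i r → r < 2 → ρ′ i (2 + r) + ρ′ i (2 + r) ≡ ρ i (2 + r) * 2 ^ suc k
    dbl i r r<2 = trans (cong (λ x → x + x) (scaled i r r<2))
      (trans (sym (*-distribˡ-+ (ρ i (2 + r)) (2 ^ k) _)) (cong (ρ i (2 + r) *_) (2^1+n k)))
    sc : ∀ i r → r < 2 → _
    sc i 0 r<2 = dbl i 0 r<2
    sc i 1 r<2 = dbl i 1 r<2
    sc i (suc (suc _)) (s≤s (s≤s ()))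

-- To keep the processors in lockstep, the body is branch-free: reg 4 becomes
-- the truth value of  M a s ≤ reg 3 and s < reg 0,  where s = reg 2 + reg 1.
binarySearch : ℕ → Program
binarySearch a = while (reg 1)
  ( load 4 a (reg 2 ⊕ reg 1)
  ∷ set 4 (lit 1 ⊖ ((reg 4 ⊖ reg 3) ⊕ (((reg 2 ⊕ reg 1) ⊕ lit 1) ⊖ reg 0)))
  ∷ set 2 (reg 2 ⊕ (reg 1 div reg 4))
  ∷ set 1 (reg 1 div lit 2)
  ∷ []) ∷ []

Monotone : (ℕ → ℕ) → ℕ → Set
Monotone f n = ∀ {j k} → j ≤ k → k ≤ n → f j ≤ f k

record Between (f : ℕ → ℕ) (n t v : ℕ) : Set where
  constructor between
  field
    v<n   : v < n
    lower : f v ≤ t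
    upper : t < f (suc v)

module _ {f n t v} (mono : Monotone f n) (b : Between f n t v) where
  open Between b

  ≤-between : ∀ {k} → k < n → f k ≤ t → k ≤ v
  ≤-between k<n fk≤t = ≮⇒≥ λ v<k → <-irrefl refl (<-≤-trans upper (≤-trans (mono v<k (<⇒≤ k<n)) fk≤t))

  between-≤ : ∀ {k} → k ≤ v → f k ≤ t
  between-≤ k≤v = ≤-trans (mono k≤v (<⇒≤ v<n)) lower

-- The value that reg 1 has when j iterations of the search are left.
stepAt : ℕ → ℕ
stepAt zero    = 0
stepAt (suc j) = 2 ^ j

stepAt-half : ∀ j → quot (2 ^ j) 2 ≡ stepAt j
stepAt-half zero    = refl
stepAt-half (suc j) = trans (cong (λ x → quot x 2) (*-comm 2 (2 ^ j))) (m*n/n≡m (2 ^ j) 2)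

-- With `j` iterations left, the answer lies in the interval of length `2 ^ j` that starts at
-- register 2. The steps are `2 ^ k`, ..., 2, 1, hence `suc k` iterations. Processors whose target
-- lies in no segment take part, but nothing is claimed about their result.
exec-binarySearch : ∀ {p} a lim k {ρ : Fin p → Registers} {M} →
  Monotone (M a) lim → lim ≤ 2 ^ k →
  (∀ i → ρ i 0 ≡ lim) → (∀ i → ρ i 1 ≡ 2 ^ k) → (∀ i → ρ i 2 ≡ 0) →
  Exec (binarySearch a) (suc (suc k * 5)) ρ M
    (λ ρ′ M′ → M′ ≡ M × (∀ i v → Between (M a) lim (ρ i 3) v → ρ′ i 2 ≡ v)
                     × (∀ i r → ρ′ i (5 + r) ≡ ρ i (5 + r)))
exec-binarySearch {p} a lim k {ρ} {M} mono lim≤ ρ0 ρ1 ρ2 =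
  exec-weaken ≤-refl finish (exec-loop I body (suc k) record
    { memory≡ = refl ; limit = ρ0 ; step≡ = ρ1 ; target = λ _ → refl ; frame = λ _ _ → refl
    ; low  = λ i v b → subst (_≤ v) (sym (ρ2 i)) z≤n
    ; high = λ i v b → subst (λ x → v < x + 2 ^ suc k) (sym (ρ2 i))
        (<-≤-trans (Between.v<n b) (≤-trans lim≤ (m≤m+n (2 ^ k) _))) })
  where
  record I (j : ℕ) (ρ′ : Fin p → Registers) (M′ : Memory) : Set where
    field
      memory≡ : M′ ≡ M
      limit   : ∀ i → ρ′ i 0 ≡ lim
      step≡   : ∀ i → ρ′ i 1 ≡ stepAt j
      target  : ∀ i → ρ′ i 3 ≡ ρ i 3
      frame   : ∀ i r → ρ′ i (5 + r) ≡ ρ i (5 + r)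
      low     : ∀ i v → Between (M a) lim (ρ i 3) v → ρ′ i 2 ≤ v
      high    : ∀ i v → Between (M a) lim (ρ i 3) v → v < ρ′ i 2 + 2 ^ j
  finish : ∀ ρ′ M′ → (∃[ j ] I j ρ′ M′) × (∀ i → ρ′ i 1 ≡ 0) → M′ ≡ M ×
    (∀ i v → Between (M a) lim (ρ i 3) v → ρ′ i 2 ≡ v) × (∀ i r → ρ′ i (5 + r) ≡ ρ i (5 + r))
  finish ρ′ M′ ((zero , inv) , g) = memory≡
    , (λ i v b → ≤-antisym (low i v b) (s≤s⁻¹ (subst (v <_) (+-comm _ 1) (high i v b)))) , frame
    where open I inv
  finish ρ′ M′ ((suc j , inv) , g) = memory≡
    , (λ i → contradiction (trans (sym (step≡ i)) (g i)) (≢-nonZero⁻¹ (2 ^ j) {{m^n≢0 2 j}})) , frame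
    where open I inv
  body : ∀ j ρ′ M′ → I j ρ′ M′ → (∀ i → ρ′ i 1 ≡ 0) ⊎
         ∃[ j′ ] j ≡ suc j′ × (∀ i → ρ′ i 1 ≢ 0) × Exec _ 4 ρ′ M′ (I j′)
  body zero    ρ′ M′ inv = inj₁ (I.step≡ inv)
  body (suc j) ρ′ M′ inv = inj₂ (j , refl
    , (λ i g → ≢-nonZero⁻¹ (2 ^ j) {{m^n≢0 2 j}} (trans (sym (step≡ i)) g))
    , exec-load (exec-set (exec-set (exec-set (exec-[] record
        { memory≡ = memory≡ ; limit = limit ; target = target ; frame = frame
        ; step≡ = λ i → trans (cong (λ x → quot x 2) (step≡ i)) (stepAt-half j)
        ; low   = λ i v b → proj₁ (narrow i v b)
        ; high  = λ i v b → proj₂ (narrow i v b) })))))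
    where
    open I inv
    -- If `s` is accepted, it is a new lower end by `≤-between`. If it is rejected, then v < s:
    -- either because v < lim ≤ s, or because s ≤ v would make the value at `s` at most the target.
    narrow : ∀ i v → Between (M a) lim (ρ i 3) v → let
      h = ρ′ i 1
      s = ρ′ i 2 + h
      c = 1 ∸ ((M′ a s ∸ ρ′ i 3) + ((s + 1) ∸ ρ′ i 0))
      in ρ′ i 2 + quot h c ≤ v × v < ρ′ i 2 + quot h c + 2 ^ j
    narrow i v b with low i v b | high i v b
    ... | lo | hi
      rewrite limit i | step≡ i | target i | memory≡ | +-comm (ρ′ i 2 + 2 ^ j) 1
      with M a (ρ′ i 2 + 2 ^ j) ≤? ρ i 3 | ρ′ i 2 + 2 ^ j <? lim
    ... | yes fs≤t | yes s<lim
      rewrite m≤n⇒m∸n≡0 fs≤t | m≤n⇒m∸n≡0 s<lim | n/1≡n (2 ^ j) =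
        ≤-between mono b s<lim fs≤t
      , subst (v <_) (trans (cong (ρ′ i 2 +_) (sym (2^1+n j))) (sym (+-assoc (ρ′ i 2) (2 ^ j) _))) hi
    ... | yes fs≤t | no s≮lim
      rewrite m≤n⇒m∸n≡0 fs≤t
      with suc (ρ′ i 2 + 2 ^ j) ∸ lim in eq
    ... | zero  = contradiction (m∸n≡0⇒m≤n eq) s≮lim
    ... | suc x rewrite 0∸n≡0 x | +-identityʳ (ρ′ i 2) =
        lo , ≰⇒> λ s≤v → s≮lim (≤-<-trans s≤v (Between.v<n b))
    narrow i v b | lo | hi | no fs≰t | _
      with M a (ρ′ i 2 + 2 ^ j) ∸ ρ i 3 in eq
    ... | zero  = contradiction (m∸n≡0⇒m≤n eq) fs≰t
    ... | suc x rewrite 0∸n≡0 (x + (suc (ρ′ i 2 + 2 ^ j) ∸ lim)) | +-identityʳ (ρ′ i 2) =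
        lo , ≰⇒> λ s≤v → fs≰t (between-≤ mono b s≤v)

prefix : (ℕ → ℕ) → ℕ → ℕ
prefix g zero    = 0
prefix g (suc k) = prefix g k + g k

-- Cell c of array a is to receive prefix g c; processor i is in charge of cell
-- i + 1, and cell 0 absorbs the reads that would be left of the array.
scan : ℕ → Program
scan a =
    set 1 (lit 1)
  ∷ set 3 (reg 5 ⊕ lit 1)
  ∷ store a (reg 3) (reg 2)
  ∷ while (reg 0 ⊖ reg 1)
    ( load 4 a (reg 3 ⊖ reg 1)
    ∷ set 2 (reg 2 ⊕ reg 4)
    ∷ store a (reg 3) (reg 2)
    ∷ set 1 (reg 1 ⊕ reg 1)
    ∷ [])
  ∷ []

-- The power of 2 left in register 1 is recorded because a later binary search takes it as its
-- initial step.
record Scanned {p} (a lim : ℕ) (g : ℕ → ℕ) (b : ℕ) (ρ : Fin p → Registers) (M : Memory)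
               (ρ′ : Fin p → Registers) (M′ : Memory) : Set where
  field
    sums  : ∀ c → c ≤ lim → M′ a c ≡ prefix g c
    other : ∀ b → b ≢ a → ∀ c → M′ b c ≡ M b c
    k     : ℕ
    k≤b   : k ≤ b
    lim≤  : lim ≤ 2 ^ k
    power : ∀ i → ρ′ i 1 ≡ 2 ^ k
    frame : ∀ i r → ρ′ i (5 + r) ≡ ρ i (5 + r)

-- Adding the cell `2 ^ k` places to the left doubles the window of terms that a cell has summed.
-- Truncated subtraction sends reads beyond the left end to cell 0, which holds 0 and is never
-- written. Processors with index at least `lim` fill cells beyond `lim`, which the cells up to
-- `lim` never read.
exec-scan : ∀ {p} a lim g b {ρ : Fin p → Registers} {M} →
  lim ≤ p → lim ≤ 2 ^ b → M a 0 ≡ 0 →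
  (∀ i → ρ i 0 ≡ lim) → (∀ i → ρ i 5 ≡ toℕ i) → (∀ i → toℕ i < lim → ρ i 2 ≡ g (toℕ i)) →
  Exec (scan a) (4 + b * 5) ρ M (Scanned a lim g b ρ M)
exec-scan {p} a lim g b {ρ} {M} lim≤p lim≤2^b M0 ρ0 ρ5 ρ2 =
  exec-set (exec-set (exec-store (own-cell λ i → cong (_+ 1) (ρ5 i))
    λ M₁ w → exec-weaken ≤-refl finish (exec-loop Inv body b (0 , refl , start-inv M₁ w))))
  where
  own-cell : ∀ {f : Fin p → ℕ} → (∀ i → f i ≡ toℕ i + 1) → ∀ i j → f i ≡ f j → i ≡ j
  own-cell h i j eq =
    Fin.toℕ-injective (+-cancelʳ-≡ 1 (toℕ i) (toℕ j) (trans (sym (h i)) (trans eq (h j))))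

  record I (k : ℕ) (ρ′ : Fin p → Registers) (M′ : Memory) : Set where
    field
      k≤b    : k ≤ b
      limit  : ∀ i → ρ′ i 0 ≡ lim
      power  : ∀ i → ρ′ i 1 ≡ 2 ^ k
      own    : ∀ i → ρ′ i 3 ≡ toℕ i + 1
      value  : ∀ i → ρ′ i 2 ≡ M′ a (toℕ i + 1)
      frame  : ∀ i r → ρ′ i (5 + r) ≡ ρ i (5 + r)
      origin : M′ a 0 ≡ 0
      other  : ∀ b → b ≢ a → ∀ c → M′ b c ≡ M b c
      -- M′ a c is the sum of the last 2 ^ k terms of prefix g c.
      window : ∀ i → toℕ i < lim → let c = toℕ i + 1 in M′ a c + prefix g (c ∸ 2 ^ k) ≡ prefix g c

  window-≤ : ∀ {k ρ′ M′} → I k ρ′ M′ → ∀ c → c ≤ lim → M′ a c + prefix g (c ∸ 2 ^ k) ≡ prefix g c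
  window-≤ {k} inv zero c≤ rewrite I.origin inv | 0∸n≡0 (2 ^ k) = refl
  window-≤ {k} {M′ = M′} inv (suc c) c≤ = subst (λ c → M′ a c + prefix g (c ∸ 2 ^ k) ≡ prefix g c)
    (trans (cong (_+ 1) (Fin.toℕ-fromℕ< c<p)) (+-comm c 1))
    (I.window inv (fromℕ< c<p) (subst (_< lim) (sym (Fin.toℕ-fromℕ< c<p)) c≤))
    where
    c<p : c < p
    c<p = <-≤-trans c≤ lim≤p

  start-inv : ∀ M₁ → Written M (λ i → a , ρ i 5 + 1) (λ i → ρ i 2) M₁ →
              I 0 (λ i → (ρ i [ 1 ≔ 1 ]) [ 3 ≔ ρ i 5 + 1 ]) M₁
  start-inv M₁ w = record
    { k≤b = z≤n ; limit = ρ0 ; power = λ _ → refl ; own = λ i → cong (_+ 1) (ρ5 i)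
    ; value = λ i → sym (hit′ i)
    ; frame = λ _ _ → refl
    ; origin = trans (miss a 0 λ i eq → case trans (+-comm 1 _) (cong proj₂ eq) of λ ()) M0
    ; other = λ b b≢a c → miss b c λ i eq → b≢a (sym (cong proj₁ eq))
    ; window = λ i i<lim → trans (cong₂ _+_ (trans (hit′ i) (ρ2 i i<lim)) (cong (prefix g) (m+n∸n≡m (toℕ i) 1)))
        (trans (+-comm (g (toℕ i)) _) (cong (prefix g) (+-comm 1 (toℕ i)))) }
    where
    open Written w
    hit′ : ∀ i → M₁ a (toℕ i + 1) ≡ ρ i 2
    hit′ i = subst (λ x → M₁ a (x + 1) ≡ ρ i 2) (ρ5 i) (hit i)

  Inv : ℕ → Assertion p
  Inv j ρ′ M′ = ∃[ k ] k + j ≡ b × I k ρ′ M′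

  prefix-∸ : ∀ {c k} → c ≤ 2 ^ k → prefix g (c ∸ 2 ^ k) ≡ 0
  prefix-∸ c≤ rewrite m≤n⇒m∸n≡0 c≤ = refl

  finish : ∀ ρ′ M′ → (∃[ j ] Inv j ρ′ M′) × (∀ i → ρ′ i 0 ∸ ρ′ i 1 ≡ 0) → Scanned a lim g b ρ M ρ′ M′
  finish ρ′ M′ ((j , k , _ , inv) , g≡0) = record
    { sums = λ c c≤ → trans (sym (+-identityʳ _))
        (trans (cong (M′ a c +_) (sym (prefix-∸ {k = k} (≤-trans c≤ lim≤)))) (window-≤ inv c c≤))
    ; other = I.other inv ; k = k ; k≤b = I.k≤b inv ; lim≤ = lim≤ ; power = I.power inv ; frame = I.frame inv }
    where
    lim≤ : lim ≤ 2 ^ k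
    -- The exit test needs a processor to be applied to; the assumption to be refuted supplies one,
    -- since it makes `lim` positive and `lim ≤ p`.
    lim≤ = ≮⇒≥ λ 2^k<lim → <⇒≱ 2^k<lim (m∸n≡0⇒m≤n (subst₂ (λ x y → x ∸ y ≡ 0)
      (I.limit inv (i₀ 2^k<lim)) (I.power inv (i₀ 2^k<lim)) (g≡0 (i₀ 2^k<lim))))
      where
      i₀ : 2 ^ k < lim → Fin p
      i₀ 2^k<lim = fromℕ< (<-≤-trans (m^n>0 2 k) (≤-trans (<⇒≤ 2^k<lim) lim≤p))

  body : ∀ j ρ′ M′ → Inv j ρ′ M′ → (∀ i → ρ′ i 0 ∸ ρ′ i 1 ≡ 0) ⊎
         ∃[ j′ ] j ≡ suc j′ × (∀ i → ρ′ i 0 ∸ ρ′ i 1 ≢ 0) × Exec _ 4 ρ′ M′ (Inv j′)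
  body j ρ′ M′ (k , k+j , inv) with lim ≤? 2 ^ k
  ... | yes lim≤2^k = inj₁ λ i → trans (cong₂ _∸_ (I.limit inv i) (I.power inv i)) (m≤n⇒m∸n≡0 lim≤2^k)
  body zero ρ′ M′ (k , k+j , inv) | no lim≰ =
    contradiction (subst (λ k → lim ≤ 2 ^ k) (trans (sym k+j) (+-identityʳ k)) lim≤2^b) lim≰
  body (suc j) ρ′ M′ (k , k+j , inv) | no lim≰ = inj₂ (j , refl
    , (λ i g≡0 → lim≰ (m∸n≡0⇒m≤n (subst₂ (λ x y → x ∸ y ≡ 0) (limit i) (power i) g≡0)))
    , exec-load (exec-set (exec-store (own-cell own) λ M″ w → exec-set (exec-[]
        (suc k , trans (sym (+-suc k j)) k+j , next M″ w)))))
    where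
    open I inv
    next : ∀ M″ → Written M′ (λ i → a , ρ′ i 3) (λ i → ρ′ i 2 + M′ a (ρ′ i 3 ∸ ρ′ i 1)) M″ → I (suc k) _ M″
    next M″ w = record
      { k≤b = subst (suc k ≤_) k+j (subst (_≤ k + suc j) (+-comm k 1) (+-monoʳ-≤ k (s≤s z≤n)))
      ; limit = limit
      ; power = λ i → trans (cong (λ x → x + x) (power i)) (2^1+n k)
      ; own = own
      ; value = λ i → sym (hit′ i)
      ; frame = frame
      ; origin = trans (miss a 0 λ i eq → case trans (+-comm 1 _) (trans (sym (own i)) (cong proj₂ eq)) of λ ()) origin
      ; other = λ b b≢a c → trans (miss b c λ i eq → b≢a (sym (cong proj₁ eq))) (other b b≢a c)
      ; window = window′ }
      where
      open Written w
      hit′ : ∀ i → M″ a (toℕ i + 1) ≡ ρ′ i 2 + M′ a (ρ′ i 3 ∸ ρ′ i 1)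
      hit′ i = subst (λ x → M″ a x ≡ ρ′ i 2 + M′ a (ρ′ i 3 ∸ ρ′ i 1)) (own i) (hit i)
      window′ : ∀ i → toℕ i < lim → let c = toℕ i + 1 in M″ a c + prefix g (c ∸ 2 ^ suc k) ≡ prefix g c
      window′ i i<lim = begin
        M″ a c + prefix g (c ∸ 2 ^ suc k)
          ≡⟨ cong₂ _+_ (trans (hit′ i) (cong₂ _+_ (value i) (cong (M′ a) (cong₂ _∸_ (own i) (power i)))))
                       (cong (prefix g) (trans (cong (c ∸_) (sym (2^1+n k))) (sym (∸-+-assoc c (2 ^ k) (2 ^ k))))) ⟩
        (M′ a c + M′ a (c ∸ 2 ^ k)) + prefix g (c ∸ 2 ^ k ∸ 2 ^ k)
          ≡⟨ +-assoc (M′ a c) _ _ ⟩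
        M′ a c + (M′ a (c ∸ 2 ^ k) + prefix g (c ∸ 2 ^ k ∸ 2 ^ k))
          ≡⟨ cong (M′ a c +_) (window-≤ inv (c ∸ 2 ^ k) (≤-trans (m∸n≤m c (2 ^ k)) c≤)) ⟩
        M′ a c + prefix g (c ∸ 2 ^ k)
          ≡⟨ window i i<lim ⟩
        prefix g c ∎
        where
        open ≡-Reasoning
        c = toℕ i + 1
        c≤ : c ≤ lim
        c≤ = subst (_≤ lim) (+-comm 1 (toℕ i)) i<lim

-- Arithmetic of searching, flattened rows, digits and selection

between-unique : ∀ {f n t v w} → Monotone f n → Between f n t v → Between f n t w → v ≡ w
between-unique mono b b′ = ≤-antisym
  (≤-between mono b′ (Between.v<n b) (Between.lower b))
  (≤-between mono b (Between.v<n b′) (Between.lower b′))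

-- A linear search that only serves to specify what the binary search finds. Its default value 0 is
-- irrelevant wherever `locate-between` applies.
locate : (ℕ → ℕ) → ℕ → ℕ → ℕ
locate f zero    t = 0
locate f (suc n) t with f n ≤? t
... | yes _ = n
... | no  _ = locate f n t

locate-between : ∀ f n {t} → f 0 ≤ t → t < f n → Between f n t (locate f n t)
locate-between f zero    f0≤t t<f = contradiction t<f (≤⇒≯ f0≤t)
locate-between f (suc n) {t} f0≤t t<f with f n ≤? t
... | yes fn≤t = between ≤-refl fn≤t t<f
... | no  fn≰t = let open Between (locate-between f n f0≤t (≰⇒> fn≰t)) in between (m<n⇒m<1+n v<n) lower upper

prefix-+ : ∀ g a b → prefix g (a + b) ≡ prefix g a + prefix (λ j → g (a + j)) b
prefix-+ g a zero    = trans (cong (prefix g) (+-identityʳ a)) (sym (+-identityʳ _))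
prefix-+ g a (suc b) = trans (cong (prefix g) (+-suc a b))
  (trans (cong (_+ g (a + b)) (prefix-+ g a b)) (+-assoc (prefix g a) _ _))

prefix-cong : ∀ {g h} k → (∀ j → j < k → g j ≡ h j) → prefix g k ≡ prefix h k
prefix-cong zero    eq = refl
prefix-cong (suc k) eq = cong₂ _+_ (prefix-cong k λ j j<k → eq j (m<n⇒m<1+n j<k)) (eq k ≤-refl)

prefix-mono : ∀ g {j k} → j ≤ k → prefix g j ≤ prefix g k
prefix-mono g {j} {k} j≤k with ≤⇒≤′ j≤k
... | ≤′-refl             = ≤-refl
... | ≤′-step {n = k} j≤′k = ≤-trans (prefix-mono g (≤′⇒≤ j≤′k)) (m≤m+n (prefix g k) (g k))

module _ (d : ℕ → ℕ) (g : ℕ → ℕ → ℕ) (L : ℕ) where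

  -- The rows g e 0, …, g e (d e - 1) for e = 0, …, L - 1, one after the other.
  flatten : ℕ → ℕ
  flatten i = let e = locate (prefix d) L i in g e (i ∸ prefix d e)

  flatten-row : ∀ {e j} → e < L → j < d e → flatten (prefix d e + j) ≡ g e j
  flatten-row {e} {j} e<L j<d = trans
    (cong (λ x → g x (prefix d e + j ∸ prefix d x)) (between-unique (λ j≤k _ → prefix-mono d j≤k)
      (locate-between (prefix d) L z≤n (<-≤-trans j< (prefix-mono d e<L)))
      (between e<L (m≤m+n _ j) j<)))
    (cong (g e) (m+n∸m≡n (prefix d e) j))
    where
    j< : prefix d e + j < prefix d (suc e)
    j< = +-monoʳ-< (prefix d e) j<d

  -- At a row boundary the prefix sum of the flattened rows is a sum of complete rows. One scan over
  -- all tests thus gives every row sum as the difference of two cells.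
  prefix-flatten : ∀ e → e ≤ L → prefix flatten (prefix d e) ≡ prefix (λ e → prefix (g e) (d e)) e
  prefix-flatten zero    _   = refl
  prefix-flatten (suc e) e<L = trans (prefix-+ flatten (prefix d e) (d e))
    (cong₂ _+_ (prefix-flatten e (<⇒≤ e<L)) (prefix-cong (d e) λ j → flatten-row e<L))

-- Uniqueness of the last digit in base `K`. It makes distinct pairs of vertices occupy distinct
-- cells of a matrix whose rows have length `K`.
positional-injective : ∀ K {x y v w} → v < K → w < K → x * K + v ≡ y * K + w → x ≡ y × v ≡ w
positional-injective K@(suc _) {x} {y} {v} {w} v<K w<K eq = *-cancelʳ-≡ x y K
  (+-cancelʳ-≡ w (x * K) (y * K) (subst (λ v → x * K + v ≡ y * K + w) v≡w eq)) , v≡w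
  where
  digit : ∀ x {v} → v < K → (x * K + v) % K ≡ v
  digit x {v} v<K = trans (cong (_% K) (+-comm (x * K) v)) (trans ([m+kn]%n≡m%n v x K) (m<n⇒m%n≡m v<K))
  v≡w : v ≡ w
  v≡w = trans (sym (digit x v<K)) (trans (cong (_% K) eq) (digit y w<K))

choose : ∀ {A : Set} → ℕ → A → A → A
choose zero    x y = x
choose (suc _) x y = y

-- Multiplication of x by a truth value b ∈ {0 , 1} is quot x b.
quot-choose : ∀ k x y → quot x (1 ∸ k) + quot y (1 ∸ (1 ∸ k)) ≡ choose k x y
quot-choose zero    x y = trans (+-identityʳ _) (n/1≡n x)
quot-choose (suc k) x y rewrite 0∸n≡0 k = n/1≡n y

-- Lets a program compute a minimum, for which `Expr` has no operator.
∸∸-⊓ : ∀ m n → m ∸ (m ∸ n) ≡ m ⊓ n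
∸∸-⊓ m n with ≤-total m n
... | inj₁ m≤n rewrite m≤n⇒m∸n≡0 m≤n = sym (m≤n⇒m⊓n≡m m≤n)
... | inj₂ n≤m = trans (m∸[m∸n]≡n n≤m) (sym (m≥n⇒m⊓n≡n n≤m))

own-injective : ∀ {p} (ρ : Fin p → Registers) → (∀ i → ρ i 5 ≡ toℕ i) → ∀ i j → ρ i 5 ≡ ρ j 5 → i ≡ j
own-injective ρ ρ5 i j eq = Fin.toℕ-injective (trans (sym (ρ5 i)) (trans eq (ρ5 j)))

exec-store-own : ∀ {p P T a e} {ρ : Fin p → Registers} {M Post} → (∀ i → ρ i 5 ≡ toℕ i) →
  (∀ M′ → (∀ i → M′ a (toℕ i) ≡ ⟦ e ⟧ (ρ i)) → (∀ b → b ≢ a → ∀ k → M′ b k ≡ M b k) → Exec P T ρ M′ Post) →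
  Exec (store a (reg 5) e ∷ P) (suc T) ρ M Post
exec-store-own {a = a} {ρ = ρ} ρ5 x = exec-store (own-injective ρ ρ5) λ M′ w → let open Written w in
  x M′ (λ i → trans (cong (M′ a) (sym (ρ5 i))) (hit i))
       (λ b b≢a k → miss b k λ i eq → b≢a (sym (cong proj₁ eq)))

-- Arcs and the quantities computed from them

-- The interface between the graph and the machine, in terms of functions on ℕ only. The two
-- alternatives of `adjacent` correspond to matrix cells that some arc sets to 1 and cells that no
-- arc writes.
record Arcs (n L : ℕ) (off tgt src : ℕ → ℕ) (adj : ℕ → ℕ → ℕ) : Set where
  field
    off-mono    : Monotone off n
    off-last    : off n ≡ L
    src-between : ∀ {e} → e < L → Between off n e (src e)
    tgt<n       : ∀ {e} → e < L → tgt e < n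
    simple      : ∀ {e e′} → e < L → e′ < L → src e ≡ src e′ → tgt e ≡ tgt e′ → e ≡ e′
    adjacent    : ∀ {x w} → x < n → w < n →
                  (adj x w ≡ 1 × ∃[ e ] e < L × src e ≡ x × tgt e ≡ w) ⊎
                  (adj x w ≡ 0 × (∀ e → e < L → ¬ (src e ≡ x × tgt e ≡ w)))

module Quantities (L : ℕ) (off tgt src : ℕ → ℕ) (adj : ℕ → ℕ → ℕ) where

  deg : ℕ → ℕ
  deg v = off (suc v) ∸ off v

  excess : ℕ → ℕ
  excess e = deg (src e) ∸ deg (tgt e)

  smaller larger d c : ℕ → ℕ
  smaller e = choose (excess e) (src e) (tgt e)
  larger  e = choose (excess e) (tgt e) (src e)
  d       e = deg (src e) ⊓ deg (tgt e)

  flag : ℕ → ℕ → ℕ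
  flag e j = adj (larger e) (tgt (off (smaller e) + j))

  c e = prefix (flag e) (d e)

  flat : ℕ → ℕ
  flat = flatten d flag L

  at-vertex : (ℕ → ℕ) → ℕ → ℕ
  at-vertex g v = prefix g (off (suc v)) ∸ prefix g (off v)

  -- The divisor `1 ∸ c e` is 1 if `c e` is 0, and 0 otherwise. So `q e` is D or 3 D of the target,
  -- that is 6 △ if the endpoints have no common neighbour and 2 △ if they have one.
  D q num : ℕ → ℕ
  D = at-vertex c
  q e = D (tgt e) + quot (D (tgt e) + D (tgt e)) (1 ∸ c e)
  num v = D v + at-vertex q v

-- The program

-- Registers 0, …, 4 are scratch; the loops leave the others alone.  Arrays:
-- 5 the adjacency matrix, 6 the prefix sums of d, 7 those of the tests, 8 those
-- of c, 9 those of q, 10 where the adjacency list of the smaller endpoint of an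
-- arc starts, 11 where the matrix row of the larger one starts, 12 scratch.
prepare compareDegrees testPairs countTriangles weigh report : Program
prepare =
    set 5 (reg 0)
  ∷ load 6 0 (lit 0)
  ∷ load 7 0 (lit 1)
  ∷ set 7 (reg 7 ⊕ reg 7)
  ∷ set 0 (reg 6)
  ∷ set 1 (lit 1)
  ∷ doubling
 ++ set 2 (lit 0)
  ∷ set 3 (reg 5)
  ∷ binarySearch 1
 ++ set 8 (reg 2)
  ∷ load 9 2 (reg 5)
  ∷ load 10 1 (reg 8)
  ∷ load 11 1 (reg 8 ⊕ lit 1)
  ∷ load 12 1 (reg 9)
  ∷ load 13 1 (reg 9 ⊕ lit 1)
  ∷ set 0 (reg 6)
  ∷ set 1 (lit 1)
  ∷ set 2 (reg 8)
  ∷ set 3 (reg 9)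
  ∷ doubling
compareDegrees =
    guardedStore (reg 7 ⊖ reg 5) 5 (reg 2 ⊕ reg 9) (lit 1) 12 (reg 5)
  ∷ set 4 (lit 1 ⊖ ((reg 11 ⊖ reg 10) ⊖ (reg 13 ⊖ reg 12)))
  ∷ store 10 (reg 5) ((reg 10 div reg 4) ⊕ (reg 12 div (lit 1 ⊖ reg 4)))
  ∷ store 11 (reg 5) ((reg 3 div reg 4) ⊕ (reg 2 div (lit 1 ⊖ reg 4)))
  ∷ set 2 ((reg 11 ⊖ reg 10) ⊖ ((reg 11 ⊖ reg 10) ⊖ (reg 13 ⊖ reg 12)))
  ∷ set 0 (reg 7)
  ∷ scan 6
testPairs =
    load 14 6 (reg 7)
  ∷ set 0 (reg 7)
  ∷ set 2 (lit 0)
  ∷ set 3 (reg 5)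
  ∷ binarySearch 6
 ++ load 3 6 (reg 2)
  ∷ load 4 10 (reg 2)
  ∷ load 4 2 (reg 4 ⊕ (reg 5 ⊖ reg 3))
  ∷ load 3 11 (reg 2)
  ∷ load 2 5 (reg 3 ⊕ reg 4)
  ∷ set 0 (reg 14)
  ∷ scan 7
countTriangles =
    load 3 6 (reg 5)
  ∷ load 4 6 (reg 5 ⊕ lit 1)
  ∷ load 3 7 (reg 3)
  ∷ load 4 7 (reg 4)
  ∷ set 15 (reg 4 ⊖ reg 3)
  ∷ set 2 (reg 15)
  ∷ set 0 (reg 7)
  ∷ scan 8
weigh =
    load 3 8 (reg 12)
  ∷ load 4 8 (reg 13)
  ∷ set 3 (reg 4 ⊖ reg 3)
  ∷ set 2 (reg 3 ⊕ ((reg 3 ⊕ reg 3) div (lit 1 ⊖ reg 15)))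
  ∷ set 0 (reg 7)
  ∷ scan 9
report =
    load 0 8 (reg 10)
  ∷ load 1 8 (reg 11)
  ∷ load 2 9 (reg 10)
  ∷ load 3 9 (reg 11)
  ∷ load 4 8 (reg 7)
  ∷ set 0 ((reg 1 ⊖ reg 0) ⊕ (reg 3 ⊖ reg 2))
  ∷ set 1 ((reg 7 ⊖ reg 5) div (lit 1 ⊖ (reg 5 ⊖ reg 10)))
  ∷ guardedStore (reg 1) 3 (reg 8) (reg 0) 12 (reg 5)
  ∷ guardedStore (reg 1) 4 (reg 8) (reg 4 ⊖ lit 1) 12 (reg 5)
  ∷ []

triangleCentrality : Program
triangleCentrality =
  prepare ++ compareDegrees ++ testPairs ++ countTriangles ++ weigh ++ report

-- Correctness of the program, phase by phase

module Correctness {p n L b : ℕ} {off tgt src adj} (arcs : Arcs n L off tgt src adj)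
  (n≤2^b : n ≤ 2 ^ b) (L≤2^b : L ≤ 2 ^ b) (W≤2^b : prefix (Quantities.d L off tgt src adj) L ≤ 2 ^ b)
  (L≤p : L ≤ p) (W≤p : prefix (Quantities.d L off tgt src adj) L ≤ p) (i₀ : Fin p) where

  open Arcs arcs
  open Quantities L off tgt src adj

  -- The index and the number of arcs are known to every processor because the guards are computed
  -- from them; the other entries make sense only for a processor that has an arc.
  record Known (ρ : Fin p → Registers) : Set where
    field
      ρ5  : ∀ i → ρ i 5 ≡ toℕ i
      ρ7  : ∀ i → ρ i 7 ≡ L
      ρ8  : ∀ i → toℕ i < L → ρ i 8 ≡ src (toℕ i)
      ρ9  : ∀ i → toℕ i < L → ρ i 9 ≡ tgt (toℕ i)
      ρ10 : ∀ i → toℕ i < L → ρ i 10 ≡ off (src (toℕ i))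
      ρ11 : ∀ i → toℕ i < L → ρ i 11 ≡ off (suc (src (toℕ i)))
      ρ12 : ∀ i → toℕ i < L → ρ i 12 ≡ off (tgt (toℕ i))
      ρ13 : ∀ i → toℕ i < L → ρ i 13 ≡ off (suc (tgt (toℕ i)))

  known-frame : ∀ {ρ ρ′} → (∀ i r → ρ′ i (5 + r) ≡ ρ i (5 + r)) → Known ρ → Known ρ′
  known-frame f k = record
    { ρ5  = λ i → trans (f i 0) (ρ5 i)
    ; ρ7  = λ i → trans (f i 2) (ρ7 i)
    ; ρ8  = λ i h → trans (f i 3) (ρ8 i h)
    ; ρ9  = λ i h → trans (f i 4) (ρ9 i h)
    ; ρ10 = λ i h → trans (f i 5) (ρ10 i h)
    ; ρ11 = λ i h → trans (f i 6) (ρ11 i h)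
    ; ρ12 = λ i h → trans (f i 7) (ρ12 i h)
    ; ρ13 = λ i h → trans (f i 8) (ρ13 i h)
    }
    where open Known k

  src<n : ∀ {e} → e < L → src e < n
  src<n e<L = Between.v<n (src-between e<L)

  -- Since `L ≤ p`, each arc has a processor of its own, and statements about processors become
  -- statements about arcs.
  for-arc : ∀ {F : ℕ → Set} → (∀ (i : Fin p) → toℕ i < L → F (toℕ i)) → ∀ {e} → e < L → F e
  for-arc {F} h e<L = subst F (Fin.toℕ-fromℕ< e<p) (h (fromℕ< e<p) (subst (_< L) (sym (Fin.toℕ-fromℕ< e<p)) e<L))
    where e<p = <-≤-trans e<L L≤p

  Prepared : Memory → Assertion p
  Prepared M₀ ρ M = M ≡ M₀ × Known ρ × ∃[ k ] n ≤ 2 ^ k ×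
    (∀ i → toℕ i < L → ρ i 2 ≡ src (toℕ i) * 2 ^ k × ρ i 3 ≡ tgt (toℕ i) * 2 ^ k)

  -- `doubling` runs twice: first to provide the initial step of the search, which the search halves
  -- down to 0, and then to scale source and target to the starts of their matrix rows.
  exec-prepare : ∀ {M} → M 0 0 ≡ n → M 0 1 + M 0 1 ≡ L →
    (∀ k → M 1 k ≡ off k) → (∀ k → M 2 k ≡ tgt k) →
    Exec prepare (6 + (suc (b * 4) + (2 + (suc (suc b * 5) + (10 + suc (b * 4))))))
      (λ i → initialRegisters (toℕ i)) M (Prepared M)
  exec-prepare {M} M00 M01 M1 M2 =
    exec-set (exec-load (exec-load (exec-set (exec-set (exec-set
      (exec-doubling n b i₀ (λ _ → M00) (λ _ → refl) n≤2^b >>= λ { ρ M′ (k , n≤2^k , dbl) → afterDoubling ρ M′ k n≤2^k dbl }))))))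
    where
    mono : Monotone (M 1) n
    mono {j} {k} j≤k k≤n rewrite M1 j | M1 k = off-mono j≤k k≤n
    ρ₀ : Fin p → Registers
    ρ₀ i = ((((((initialRegisters (toℕ i) [ 5 ≔ toℕ i ]) [ 6 ≔ M 0 0 ]) [ 7 ≔ M 0 1 ]) [ 7 ≔ M 0 1 + M 0 1 ])
      [ 0 ≔ M 0 0 ]) [ 1 ≔ 1 ])
    afterDoubling : ∀ ρ M′ k → n ≤ 2 ^ k → Doubled n b ρ₀ M k ρ M′ → Exec _ _ ρ M′ (Prepared M)
    afterDoubling ρ .M k n≤2^k record { k≤b = k≤b ; memory≡ = refl ; limit = limit ; power = power ; frame = frame } =
      exec-set (exec-set (
        exec-weaken (s≤s (*-monoˡ-≤ 5 (s≤s k≤b))) (λ _ _ x → x)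
          (exec-binarySearch 1 n k mono n≤2^k limit power (λ _ → refl))
        >>= λ { ρ₁ .M (refl , found , frame₁) →
      let v≡ : ∀ i → toℕ i < L → ρ₁ i 2 ≡ src (toℕ i)
          v≡ i i<L = found i _ (search i i<L)
      in
      exec-set (exec-load (exec-load (exec-load (exec-load (exec-load (exec-set (exec-set (exec-set (exec-set
        (exec-weaken ≤-refl (λ ρ₂ M″ x → prepared ρ₁ v≡ frame₁ ρ₂ M″ x) (exec-doubling n b i₀
          (λ i → trans (frame₁ i 1) (trans (frame i 2) M00)) (λ _ → refl) n≤2^b))))))))))) }))
      where
      search : ∀ i → toℕ i < L → Between (M 1) n (ρ i 5) (src (toℕ i))
      search i i<L rewrite frame i 1 = let open Between (src-between i<L) in
        between v<n (subst (_≤ toℕ i) (sym (M1 _)) lower) (subst (toℕ i <_) (sym (M1 _)) upper)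
      ρ₁′ : (Fin p → Registers) → Fin p → Registers
      ρ₁′ ρ₁ i = let
        v = ρ₁ i 2
        u = M 2 (ρ₁ i 5)
        in (((((((((ρ₁ i [ 8 ≔ v ]) [ 9 ≔ u ]) [ 10 ≔ M 1 v ]) [ 11 ≔ M 1 (v + 1) ]) [ 12 ≔ M 1 u ])
          [ 13 ≔ M 1 (u + 1) ]) [ 0 ≔ ρ₁ i 6 ]) [ 1 ≔ 1 ]) [ 2 ≔ v ]) [ 3 ≔ u ]
      prepared : ∀ ρ₁ → (∀ i → toℕ i < L → ρ₁ i 2 ≡ src (toℕ i)) → (∀ i r → ρ₁ i (5 + r) ≡ ρ i (5 + r)) →
                 ∀ ρ₂ M″ → (∃[ k ] n ≤ 2 ^ k × Doubled n b (ρ₁′ ρ₁) M k ρ₂ M″) → Prepared M ρ₂ M″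
      prepared ρ₁ v≡ frame₁ ρ₂ M″ (k′ , n≤2^k′ , record { memory≡ = refl ; scaled = scaled ; frame = frame₂ }) =
        refl , known-frame {ρ₁′ ρ₁} (λ i r → frame₂ i (suc r)) (record
          { ρ5 = i≡
          ; ρ7 = λ i → trans (frame₁ i 2) (trans (frame i 3) M01)
          ; ρ8 = v≡
          ; ρ9 = u≡
          ; ρ10 = λ i i<L → trans (M1 _) (cong off (v≡ i i<L))
          ; ρ11 = λ i i<L → trans (M1 _) (cong off (trans (+-comm _ 1) (cong suc (v≡ i i<L))))
          ; ρ12 = λ i i<L → trans (M1 _) (cong off (u≡ i i<L))
          ; ρ13 = λ i i<L → trans (M1 _) (cong off (trans (+-comm _ 1) (cong suc (u≡ i i<L))))
          }) , k′ , n≤2^k′ , λ i i<L →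
          trans (scaled i 0 (s≤s z≤n)) (cong (_* 2 ^ k′) (v≡ i i<L)) ,
          trans (scaled i 1 (s≤s (s≤s z≤n))) (cong (_* 2 ^ k′) (u≡ i i<L))
        where
        i≡ : ∀ i → ρ₁ i 5 ≡ toℕ i
        i≡ i = trans (frame₁ i 0) (frame i 1)
        u≡ : ∀ i → toℕ i < L → M 2 (ρ₁ i 5) ≡ tgt (toℕ i)
        u≡ i _ = trans (M2 _) (cong tgt (i≡ i))

  scanned-known : ∀ {a lim g b ρ M ρ′ M′} → Scanned a lim g b ρ M ρ′ M′ → Known ρ → Known ρ′
  scanned-known {ρ = ρ} s = known-frame {ρ} (Scanned.frame s)

  record Powers (lim : ℕ) (ρ : Fin p → Registers) : Set where
    constructor powers
    field
      k     : ℕ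
      k≤b   : k ≤ b
      lim≤  : lim ≤ 2 ^ k
      power : ∀ i → ρ i 1 ≡ 2 ^ k

  -- Blank arrays are tracked for two reasons: each later scan needs a 0 in cell 0 of its array, and
  -- the outputs of isolated vertices are never written.
  record Allocated (ρ : Fin p → Registers) (M : Memory) : Set where
    field
      known  : Known ρ
      power  : Powers L ρ
      M2     : ∀ k → M 2 k ≡ tgt k
      K      : ℕ
      matrix : ∀ {x w} → x < n → w < n → M 5 (x * K + w) ≡ adj x w
      M6     : ∀ e → e ≤ L → M 6 e ≡ prefix d e
      M10    : ∀ {e} → e < L → M 10 e ≡ off (smaller e)
      M11    : ∀ {e} → e < L → M 11 e ≡ larger e * K
      M3     : ∀ k → M 3 k ≡ 0
      M4     : ∀ k → M 4 k ≡ 0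
      M7     : ∀ k → M 7 k ≡ 0
      M8     : ∀ k → M 8 k ≡ 0
      M9     : ∀ k → M 9 k ≡ 0

  exec-compareDegrees : ∀ {M₀ ρ M} → (∀ k → M₀ 2 k ≡ tgt k) → (∀ a k → M₀ (3 + a) k ≡ 0) →
    Prepared M₀ ρ M → Exec compareDegrees (2 + (5 + (4 + b * 5))) ρ M Allocated
  exec-compareDegrees {M} {ρ} M2 blank (refl , kn , k , n≤2^k , scaled) =
    exec-guardedStore index-injective (own-injective ρ ρ5) (λ ()) λ M₁ hit miss other₁ →
    exec-set (
    exec-store-own ρ5 λ M₂ hit₂ other₂ →
    exec-store-own ρ5 λ M₃ hit₃ other₃ →
    exec-set (exec-set (
    let
      same₃ : ∀ a → a ≢ 5 → a ≢ 12 → a ≢ 10 → a ≢ 11 → ∀ k → M₃ a k ≡ M a k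
      same₃ a a≢5 a≢12 a≢10 a≢11 k = trans (other₃ a a≢11 k) (trans (other₂ a a≢10 k) (other₁ a a≢5 a≢12 k))
    in
    exec-weaken ≤-refl (λ ρ′ M₄ s → let
        open Scanned s hiding (k; k≤b; lim≤; power)
        same₄ : ∀ a → a ≢ 6 → a ≢ 5 → a ≢ 12 → a ≢ 10 → a ≢ 11 → ∀ k → M₄ a k ≡ M a k
        same₄ a a≢6 a≢5 a≢12 a≢10 a≢11 k = trans (other a a≢6 k) (same₃ a a≢5 a≢12 a≢10 a≢11 k)
      in record
        { known = known-frame {ρ} frame kn
        ; power = powers (Scanned.k s) (Scanned.k≤b s) (Scanned.lim≤ s) (Scanned.power s)
        ; M2 = λ j → trans (same₄ 2 (λ ()) (λ ()) (λ ()) (λ ()) (λ ()) j) (M2 j)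
        ; K = 2 ^ k
        ; matrix = λ {x} {w} x<n w<n → trans
            (trans (other 5 (λ ()) _) (trans (other₃ 5 (λ ()) _) (other₂ 5 (λ ()) _)))
            (matrix₁ M₁ hit miss x<n w<n)
        ; M6 = sums
        ; M10 = for-arc λ i i<L → trans (trans (other 10 (λ ()) _) (other₃ 10 (λ ()) _)) (trans (hit₂ i)
            (trans (selected (ρ i 10) (ρ i 12) (ex≡ i i<L)) (trans
              (cong₂ (choose (excess (toℕ i))) (ρ10 i i<L) (ρ12 i i<L)) (sym (choose-map off (excess (toℕ i)))))))
        ; M11 = for-arc {λ e → M₄ 11 e ≡ larger e * 2 ^ k} λ i i<L → trans (other 11 (λ ()) _) (trans (hit₃ i)
            (trans (selected (ρ i 3) (ρ i 2) (ex≡ i i<L)) (trans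
              (cong₂ (choose (excess (toℕ i))) (proj₂ (scaled i i<L)) (proj₁ (scaled i i<L)))
              (sym (choose-map (_* 2 ^ k) (excess (toℕ i)))))))
        ; M3 = λ j → trans (same₄ 3 (λ ()) (λ ()) (λ ()) (λ ()) (λ ()) j) (blank 0 j)
        ; M4 = λ j → trans (same₄ 4 (λ ()) (λ ()) (λ ()) (λ ()) (λ ()) j) (blank 1 j)
        ; M7 = λ j → trans (same₄ 7 (λ ()) (λ ()) (λ ()) (λ ()) (λ ()) j) (blank 4 j)
        ; M8 = λ j → trans (same₄ 8 (λ ()) (λ ()) (λ ()) (λ ()) (λ ()) j) (blank 5 j)
        ; M9 = λ j → trans (same₄ 9 (λ ()) (λ ()) (λ ()) (λ ()) (λ ()) j) (blank 6 j)
        })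
      (exec-scan 6 L d b L≤p L≤2^b
        (trans (same₃ 6 (λ ()) (λ ()) (λ ()) (λ ()) 0) (blank 3 0)) ρ7 ρ5
        (λ i i<L → trans (∸∸-⊓ (ρ i 11 ∸ ρ i 10) (ρ i 13 ∸ ρ i 12)) (cong₂ _⊓_ (deg-src i i<L) (deg-tgt i i<L)))))))
    where
    open Known kn
    active : ∀ i → ρ i 7 ∸ ρ i 5 ≢ 0 → toℕ i < L
    active i g = subst₂ _<_ (ρ5 i) (ρ7 i) (m∸n≢0⇒n<m g)
    index≡ : ∀ i → toℕ i < L → ρ i 2 + ρ i 9 ≡ src (toℕ i) * 2 ^ k + tgt (toℕ i)
    index≡ i i<L = cong₂ _+_ (proj₁ (scaled i i<L)) (ρ9 i i<L)
    -- Exclusiveness of the matrix writes rests on the graph here: equal cells give equal sources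
    -- and targets, and no neighbour is listed twice.
    index-injective : ∀ i j → ρ i 7 ∸ ρ i 5 ≢ 0 → ρ j 7 ∸ ρ j 5 ≢ 0 → ρ i 2 + ρ i 9 ≡ ρ j 2 + ρ j 9 → i ≡ j
    index-injective i j gi gj eq with positional-injective (2 ^ k)
      (<-≤-trans (tgt<n (active i gi)) n≤2^k) (<-≤-trans (tgt<n (active j gj)) n≤2^k)
      (trans (sym (index≡ i (active i gi))) (trans eq (index≡ j (active j gj))))
    ... | s≡ , t≡ = Fin.toℕ-injective (simple (active i gi) (active j gj) s≡ t≡)
    deg-src : ∀ i → toℕ i < L → ρ i 11 ∸ ρ i 10 ≡ deg (src (toℕ i))
    deg-src i i<L = cong₂ _∸_ (ρ11 i i<L) (ρ10 i i<L)
    deg-tgt : ∀ i → toℕ i < L → ρ i 13 ∸ ρ i 12 ≡ deg (tgt (toℕ i))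
    deg-tgt i i<L = cong₂ _∸_ (ρ13 i i<L) (ρ12 i i<L)
    ex≡ : ∀ i → toℕ i < L → (ρ i 11 ∸ ρ i 10) ∸ (ρ i 13 ∸ ρ i 12) ≡ excess (toℕ i)
    ex≡ i i<L = cong₂ _∸_ (deg-src i i<L) (deg-tgt i i<L)
    selected : ∀ {k k′} x y → k ≡ k′ → quot x (1 ∸ k) + quot y (1 ∸ (1 ∸ k)) ≡ choose k′ x y
    selected {k} x y refl = quot-choose k x y
    choose-map : ∀ (f : ℕ → ℕ) k {x y} → f (choose k x y) ≡ choose k (f x) (f y)
    choose-map f zero    = refl
    choose-map f (suc _) = refl
    matrix₁ : ∀ M₁ →
      (∀ i → ρ i 7 ∸ ρ i 5 ≢ 0 → M₁ 5 (ρ i 2 + ρ i 9) ≡ 1) →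
      (∀ j → (∀ i → ρ i 7 ∸ ρ i 5 ≢ 0 → ρ i 2 + ρ i 9 ≢ j) → M₁ 5 j ≡ M 5 j) →
      ∀ {x w} → x < n → w < n → M₁ 5 (x * 2 ^ k + w) ≡ adj x w
    matrix₁ M₁ hit miss x<n w<n with adjacent x<n w<n
    ... | inj₁ (a≡1 , e , e<L , refl , refl) = trans (written e<L) (sym a≡1)
      where
      written : ∀ {e} → e < L → M₁ 5 (src e * 2 ^ k + tgt e) ≡ 1
      written = for-arc λ i i<L → trans (cong (M₁ 5) (sym (index≡ i i<L)))
        (hit i (subst₂ (λ x y → x ∸ y ≢ 0) (sym (ρ7 i)) (sym (ρ5 i)) (m>n⇒m∸n≢0 i<L)))
    ... | inj₂ (a≡0 , none) = trans (miss _ λ i g eq → none (toℕ i) (active i g)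
        (positional-injective (2 ^ k) (<-≤-trans (tgt<n (active i g)) n≤2^k) (<-≤-trans w<n n≤2^k)
          (trans (sym (index≡ i (active i g))) eq)))
        (trans (blank 2 _) (sym a≡0))

  W : ℕ
  W = prefix d L

  d-mono : Monotone (prefix d) L
  d-mono j≤k _ = prefix-mono d j≤k

  choose-< : ∀ k {x y} → x < n → y < n → choose k x y < n
  choose-< zero    x<n y<n = x<n
  choose-< (suc _) x<n y<n = y<n

  d≤deg-smaller : ∀ e → d e ≤ deg (smaller e)
  d≤deg-smaller e with excess e
  ... | zero  = m⊓n≤m _ _
  ... | suc _ = m⊓n≤n (deg (src e)) _

  off≤L : ∀ {v} → v ≤ n → off v ≤ L
  off≤L v≤n = subst (_ ≤_) off-last (off-mono v≤n ≤-refl)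

  -- The read at this position stays within the adjacency list of the smaller endpoint, so it
  -- returns a vertex and the matrix lookup is covered by `matrix`.
  pair<L : ∀ {e j} → e < L → j < d e → off (smaller e) + j < L
  pair<L {e} {j} e<L j<d = <-≤-trans
    (+-monoʳ-< (off (smaller e)) (<-≤-trans j<d (d≤deg-smaller e)))
    (≤-trans (≤-reflexive (m+[n∸m]≡n (off-mono (n≤1+n _) smaller<n))) (off≤L smaller<n))
    where
    smaller<n : smaller e < n
    smaller<n = choose-< (excess e) (src<n e<L) (tgt<n e<L)

  record Tested (ρ : Fin p → Registers) (M : Memory) : Set where
    field
      known : Known ρ
      M6    : ∀ e → e ≤ L → M 6 e ≡ prefix d e
      M7    : ∀ k → k ≤ W → M 7 k ≡ prefix flat k
      M3    : ∀ k → M 3 k ≡ 0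
      M4    : ∀ k → M 4 k ≡ 0
      M8    : ∀ k → M 8 k ≡ 0
      M9    : ∀ k → M 9 k ≡ 0

  -- The number `W` of tests depends on the data; every processor reads it from the last prefix sum
  -- into register 14. Register 1 still holds a power of 2 that is at least `L`, from the scan
  -- before.
  exec-testPairs : ∀ {ρ M} → Allocated ρ M →
    Exec testPairs (4 + (suc (suc b * 5) + (6 + (4 + b * 5)))) ρ M Tested
  exec-testPairs {ρ} {M} al = exec-load (exec-set (exec-set (exec-set (
    exec-weaken (s≤s (*-monoˡ-≤ 5 (s≤s k≤b))) (λ _ _ x → x)
      (exec-binarySearch 6 L k mono lim≤ ρ7 power (λ _ → refl))
    >>= λ { ρ₁ M (refl , found , frame) → afterSearch ρ₁ found frame }))))
    where
    open Allocated al renaming (power to pow)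
    open Powers pow
    open module known = Known known
    mono : Monotone (M 6) L
    mono {i} {j} i≤j j≤L = subst₂ _≤_ (sym (M6 i (≤-trans i≤j j≤L))) (sym (M6 j j≤L)) (d-mono i≤j j≤L)
    ρ₀ : Fin p → Registers
    ρ₀ i = (((ρ i [ 14 ≔ M 6 (ρ i 7) ]) [ 0 ≔ ρ i 7 ]) [ 2 ≔ 0 ]) [ 3 ≔ ρ i 5 ]
    afterSearch : ∀ ρ₁ → (∀ i v → Between (M 6) L (ρ i 5) v → ρ₁ i 2 ≡ v) →
      (∀ i r → ρ₁ i (5 + r) ≡ ρ₀ i (5 + r)) → Exec _ (6 + (4 + b * 5)) ρ₁ M Tested
    afterSearch ρ₁ found frame = exec-load (exec-load (exec-load (exec-load (exec-load (exec-set (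
      exec-weaken ≤-refl (λ ρ′ M′ s → let open Scanned s using (sums; other) in record
        { known = known-frame {ρ₀} (λ i r → trans (Scanned.frame s i r) (frame i r))
            -- Rebuilt field by field: `ρ₀` is not `ρ`, but both agree by computation on each
            -- register that `Known` mentions.
            (record { known })
        ; M6 = λ e e≤L → trans (other 6 (λ ()) e) (M6 e e≤L)
        ; M7 = sums
        ; M3 = λ j → trans (other 3 (λ ()) j) (M3 j)
        ; M4 = λ j → trans (other 4 (λ ()) j) (M4 j)
        ; M8 = λ j → trans (other 8 (λ ()) j) (M8 j)
        ; M9 = λ j → trans (other 9 (λ ()) j) (M9 j)
        })
      (exec-scan 7 W flat b W≤p W≤2^b (M7 0)
        (λ i → trans (frame i 9) (trans (cong (M 6) (ρ7 i)) (M6 L ≤-refl)))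
        i≡ flat≡)))))))
      where
      i≡ : ∀ i → ρ₁ i 5 ≡ toℕ i
      i≡ i = trans (frame i 0) (ρ5 i)
      flat≡ : ∀ i → toℕ i < W →
        M 5 (M 11 (ρ₁ i 2) + M 2 (M 10 (ρ₁ i 2) + (ρ₁ i 5 ∸ M 6 (ρ₁ i 2)))) ≡ flat (toℕ i)
      flat≡ i i<W = begin
        M 5 (M 11 (ρ₁ i 2) + M 2 (M 10 (ρ₁ i 2) + (ρ₁ i 5 ∸ M 6 (ρ₁ i 2))))
          ≡⟨ cong₂ (λ e i → M 5 (M 11 e + M 2 (M 10 e + (i ∸ M 6 e)))) found′ (i≡ i) ⟩
        M 5 (M 11 e + M 2 (M 10 e + (toℕ i ∸ M 6 e)))
          ≡⟨ cong (M 5) (cong₂ _+_ (M11 e<L) (trans (M2 _) (cong tgt (cong₂ _+_ (M10 e<L) (cong (toℕ i ∸_) (M6 e (<⇒≤ e<L))))))) ⟩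
        M 5 (larger e * K + tgt (off (smaller e) + (toℕ i ∸ prefix d e)))
          ≡⟨ matrix (choose-< (excess e) (tgt<n e<L) (src<n e<L)) (tgt<n (pair<L e<L j<d)) ⟩
        flat (toℕ i) ∎
        where
        open ≡-Reasoning
        e = locate (prefix d) L (toℕ i)
        bt : Between (prefix d) L (toℕ i) e
        bt = locate-between (prefix d) L z≤n i<W
        e<L : e < L
        e<L = Between.v<n bt
        found′ : ρ₁ i 2 ≡ e
        found′ = found i e (between e<L
          (subst₂ _≤_ (sym (M6 e (<⇒≤ e<L))) (sym (ρ5 i)) (Between.lower bt))
          (subst₂ _<_ (sym (ρ5 i)) (sym (M6 (suc e) e<L)) (Between.upper bt)))
        j<d : toℕ i ∸ prefix d e < d e
        j<d = subst (toℕ i ∸ prefix d e <_) (m+n∸m≡n (prefix d e) (d e))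
          (∸-monoˡ-< (Between.upper bt) (Between.lower bt))

  record Counted (ρ : Fin p → Registers) (M : Memory) : Set where
    field
      known : Known ρ
      ρ15   : ∀ i → toℕ i < L → ρ i 15 ≡ c (toℕ i)
      M8    : ∀ e → e ≤ L → M 8 e ≡ prefix c e
      M3    : ∀ k → M 3 k ≡ 0
      M4    : ∀ k → M 4 k ≡ 0
      M9    : ∀ k → M 9 k ≡ 0

  exec-countTriangles : ∀ {ρ M} → Tested ρ M → Exec countTriangles (7 + (4 + b * 5)) ρ M Counted
  exec-countTriangles {ρ} {M} te =
    exec-load (exec-load (exec-load (exec-load (exec-set (exec-set (exec-set (
      exec-weaken ≤-refl (λ ρ′ M′ s → let open Scanned s in record
        { known = scanned-known s (record { known })
        ; ρ15 = λ i i<L → trans (frame i 10) (c≡ i i<L)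
        ; M8 = sums
        ; M3 = λ j → trans (other 3 (λ ()) j) (M3 j)
        ; M4 = λ j → trans (other 4 (λ ()) j) (M4 j)
        ; M9 = λ j → trans (other 9 (λ ()) j) (M9 j)
        })
      (exec-scan 8 L c b L≤p L≤2^b (M8 0) ρ7 ρ5 c≡))))))))
    where
    open Tested te
    open module known = Known known
    M7-prefix : ∀ {x} e → x ≡ e → e ≤ L → M 7 (M 6 x) ≡ prefix c e
    M7-prefix e refl e≤L = trans (cong (M 7) (M6 e e≤L))
      (trans (M7 _ (prefix-mono d e≤L)) (prefix-flatten d flag L e e≤L))
    c≡ : ∀ i → toℕ i < L → M 7 (M 6 (ρ i 5 + 1)) ∸ M 7 (M 6 (ρ i 5)) ≡ c (toℕ i)
    c≡ i i<L = trans (cong₂ _∸_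
      (M7-prefix (suc (toℕ i)) (trans (+-comm _ 1) (cong suc (ρ5 i))) i<L) (M7-prefix (toℕ i) (ρ5 i) (<⇒≤ i<L)))
      (m+n∸m≡n (prefix c (toℕ i)) _)

  record Weighed (ρ : Fin p → Registers) (M : Memory) : Set where
    field
      known : Known ρ
      M8    : ∀ e → e ≤ L → M 8 e ≡ prefix c e
      M9    : ∀ e → e ≤ L → M 9 e ≡ prefix q e
      M3    : ∀ k → M 3 k ≡ 0
      M4    : ∀ k → M 4 k ≡ 0

  at-vertex≡ : ∀ {f g : ℕ → ℕ} {v x y} → (∀ e → e ≤ L → f e ≡ prefix g e) → v < n →
    x ≡ off (suc v) → y ≡ off v → f x ∸ f y ≡ at-vertex g v
  at-vertex≡ f≡ v<n refl refl = cong₂ _∸_ (f≡ _ (off≤L v<n)) (f≡ _ (off≤L (<⇒≤ v<n)))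

  exec-weigh : ∀ {ρ M} → Counted ρ M → Exec weigh (5 + (4 + b * 5)) ρ M Weighed
  exec-weigh {ρ} {M} co =
    exec-load (exec-load (exec-set (exec-set (exec-set (
      exec-weaken ≤-refl (λ ρ′ M′ s → let open Scanned s in record
        { known = scanned-known s (record { known })
        ; M8 = λ e e≤L → trans (other 8 (λ ()) e) (M8 e e≤L)
        ; M9 = sums
        ; M3 = λ j → trans (other 3 (λ ()) j) (M3 j)
        ; M4 = λ j → trans (other 4 (λ ()) j) (M4 j)
        })
      (exec-scan 9 L q b L≤p L≤2^b (M9 0) ρ7 ρ5
        (λ i i<L → cong₂ (λ D c → D + quot (D + D) (1 ∸ c))
          (at-vertex≡ {f = M 8} M8 (tgt<n i<L) (ρ13 i i<L) (ρ12 i i<L)) (ρ15 i i<L))))))))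
    where
    open Counted co
    open module known = Known known

  -- An isolated vertex has no arc and hence no processor to write its output; its blank cells read
  -- as 0 / 1. For the others the denominator is stored less 1, as the output format demands.
  Reported : Assertion p
  Reported ρ M = ∀ {v} → v < n →
    (off v < off (suc v) → M 3 v ≡ num v × M 4 v ≡ prefix c L ∸ 1) ×
    (off (suc v) ≤ off v → M 3 v ≡ 0 × M 4 v ≡ 0)

  0-quot : ∀ k → quot 0 k ≡ 0
  0-quot zero    = refl
  0-quot (suc k) = 0/n≡0 (suc k)

  exec-report : ∀ {ρ M} → Weighed ρ M → Exec report 11 ρ M Reported
  exec-report {ρ} {M} we =
    exec-load (exec-load (exec-load (exec-load (exec-load (exec-set (exec-set (
    exec-guardedStore store-injective (own-injective ρ ρ5) (λ ()) λ M₁ hit₁ miss₁ other₁ →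
    exec-guardedStore store-injective (own-injective ρ ρ5) (λ ()) λ M₂ hit₂ miss₂ other₂ →
    exec-[] λ {v} v<n →
      (λ off< → let
          e<L = <-≤-trans off< (off≤L v<n)
          src≡ = between-unique off-mono (src-between e<L) (between v<n ≤-refl off<)
        in trans (other₂ 3 (λ ()) (λ ()) v) (stored M₁ 3 num hit₁
             (λ i i<L → cong₂ _+_ (at-vertex≡ {f = M 8} M8 (src<n i<L) (ρ11 i i<L) (ρ10 i i<L))
                                 (at-vertex≡ {f = M 9} M9 (src<n i<L) (ρ11 i i<L) (ρ10 i i<L))) e<L src≡)
         , stored M₂ 4 (λ _ → prefix c L ∸ 1) hit₂
             (λ i i<L → cong (_∸ 1) (trans (cong (M 8) (ρ7 i)) (M8 L ≤-refl))) e<L src≡) ,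
      (λ off≥ → let none = λ i g → isolated i g off≥ in
          trans (other₂ 3 (λ ()) (λ ()) v) (trans (miss₁ v none) (M3 v))
        , trans (miss₂ v none) (trans (other₁ 4 (λ ()) (λ ()) v) (M4 v)))
    )))))))
    where
    open Weighed we
    open Known known
    -- L - i divided by the truth value of i ≤ off (src i): nonzero exactly for the first arc of
    -- each source, so every vertex has at most one writer.
    guard : Fin p → ℕ
    guard i = quot (ρ i 7 ∸ ρ i 5) (1 ∸ (ρ i 5 ∸ ρ i 10))
    active : ∀ i → guard i ≢ 0 → toℕ i < L
    active i g = ≰⇒> λ L≤i → g (trans
      (cong (λ x → quot x (1 ∸ (ρ i 5 ∸ ρ i 10))) (trans (cong₂ _∸_ (ρ7 i) (ρ5 i)) (m≤n⇒m∸n≡0 L≤i)))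
      (0-quot (1 ∸ (ρ i 5 ∸ ρ i 10))))
    first : ∀ i → guard i ≢ 0 → toℕ i ≡ off (src (toℕ i))
    first i g = ≤-antisym (m∸n≡0⇒m≤n (zero? (ρ i 5 ∸ ρ i 10) g (cong₂ _∸_ (ρ5 i) (ρ10 i (active i g)))))
                          (Between.lower (src-between (active i g)))
      where
      zero? : ∀ {x y} z → quot x (1 ∸ z) ≢ 0 → z ≡ y → y ≡ 0
      zero? zero    g refl = refl
      zero? {x} (suc z) g refl = contradiction (cong (quot x) (0∸n≡0 z)) g
    guard-on : ∀ i → toℕ i < L → toℕ i ≡ off (src (toℕ i)) → guard i ≢ 0
    guard-on i i<L eq g = m>n⇒m∸n≢0 i<L (trans (sym (n/1≡n _)) (trans
      (cong₂ (λ x y → quot x (1 ∸ y)) (sym (cong₂ _∸_ (ρ7 i) (ρ5 i)))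
        (sym (trans (cong₂ _∸_ (ρ5 i) (trans (ρ10 i i<L) (sym eq))) (n∸n≡0 (toℕ i))))) g))
    store-injective : ∀ i j → guard i ≢ 0 → guard j ≢ 0 → ρ i 8 ≡ ρ j 8 → i ≡ j
    store-injective i j gi gj eq = Fin.toℕ-injective (trans (first i gi) (trans
      (cong off (trans (sym (ρ8 i (active i gi))) (trans eq (ρ8 j (active j gj))))) (sym (first j gj))))
    isolated : ∀ {v} i → guard i ≢ 0 → off (suc v) ≤ off v → ρ i 8 ≢ v
    isolated i g off≥ eq with trans (sym (ρ8 i (active i g))) eq
    ... | refl = let open Between (src-between (active i g)) in <⇒≱ (≤-<-trans lower upper) off≥
    stored : ∀ M′ a (f : ℕ → ℕ) {val : Fin p → ℕ} → (∀ i → guard i ≢ 0 → M′ a (ρ i 8) ≡ val i) →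
      (∀ i → toℕ i < L → val i ≡ f (src (toℕ i))) → ∀ {v} → off v < L → src (off v) ≡ v → M′ a v ≡ f v
    stored M′ a f hit val≡ {v} e<L src≡ = subst (λ v → M′ a v ≡ f v) src≡
      (for-arc {λ e → e ≡ off (src e) → M′ a (src e) ≡ f (src e)}
        (λ i i<L eq → trans (cong (M′ a) (sym (ρ8 i i<L))) (trans (hit i (guard-on i i<L eq)) (val≡ i i<L)))
        e<L (cong off (sym src≡)))

  duration : ℕ
  duration = (6 + (suc (b * 4) + (2 + (suc (suc b * 5) + (10 + suc (b * 4)))))) + ((2 + (5 + (4 + b * 5))) +
    ((4 + (suc (suc b * 5) + (6 + (4 + b * 5)))) + ((7 + (4 + b * 5)) + ((5 + (4 + b * 5)) + 11))))

  exec-triangleCentrality : ∀ {M} → M 0 0 ≡ n → M 0 1 + M 0 1 ≡ L →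
    (∀ k → M 1 k ≡ off k) → (∀ k → M 2 k ≡ tgt k) → (∀ a k → M (3 + a) k ≡ 0) →
    Exec triangleCentrality duration (λ i → initialRegisters (toℕ i)) M Reported
  exec-triangleCentrality M00 M01 M1 M2 blank =
    exec-++ prepare        (exec-prepare M00 M01 M1 M2)   λ { _ _ pr@(refl , _) →
    exec-++ compareDegrees (exec-compareDegrees M2 blank pr) λ _ _ al →
    exec-++ testPairs      (exec-testPairs al)            λ _ _ te →
    exec-++ countTriangles (exec-countTriangles te)       λ _ _ co →
    exec-++ weigh          (exec-weigh co)                λ _ _ we →
    exec-report we }

-- Sums over lists and over pairs and triples of vertices

-- The Iverson bracket. It looks at `does` only, so that brackets of compound decisions reduce.
⟨_⟩ : ∀ {P : Set} → Dec P → ℕ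
⟨ P? ⟩ = if does P? then 1 else 0

⟨⟩-yes : ∀ {P : Set} (P? : Dec P) → P → ⟨ P? ⟩ ≡ 1
⟨⟩-yes (yes _) _ = refl
⟨⟩-yes (no ¬p) p = contradiction p ¬p

⟨⟩-no : ∀ {P : Set} (P? : Dec P) → ¬ P → ⟨ P? ⟩ ≡ 0
⟨⟩-no (yes p) ¬p = contradiction p ¬p
⟨⟩-no (no _)  _  = refl

⟨⟩-holds : ∀ {P : Set} (P? : Dec P) → ⟨ P? ⟩ ≡ 1 → P
⟨⟩-holds (yes p) _ = p

⟨⟩-⇔ : ∀ {P Q : Set} (P? : Dec P) (Q? : Dec Q) → (P → Q) → (Q → P) → ⟨ P? ⟩ ≡ ⟨ Q? ⟩
⟨⟩-⇔ (yes p) Q? f g = sym (⟨⟩-yes Q? (f p))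
⟨⟩-⇔ (no ¬p) Q? f g = sym (⟨⟩-no Q? (¬p ∘ g))

⟨⟩-× : ∀ {P Q : Set} (P? : Dec P) (Q? : Dec Q) → ⟨ P? ×-dec Q? ⟩ ≡ ⟨ P? ⟩ * ⟨ Q? ⟩
⟨⟩-× P? Q? with does P?
... | true  = sym (+-identityʳ _)
... | false = refl

module _ {A : Set} where

  listSum : (A → ℕ) → List A → ℕ
  listSum f xs = List.sum (map f xs)

  listSum-cong : ∀ {f g} → (∀ x → f x ≡ g x) → ∀ xs → listSum f xs ≡ listSum g xs
  listSum-cong f≗g []       = refl
  listSum-cong f≗g (x ∷ xs) = cong₂ _+_ (f≗g x) (listSum-cong f≗g xs)

  length-listSum : ∀ xs → length xs ≡ listSum (λ _ → 1) xs
  length-listSum []       = refl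
  length-listSum (x ∷ xs) = cong suc (length-listSum xs)

  listSum-filter : ∀ {P : Pred A 0ℓ} (P? : Decidable P) f xs →
                   listSum f (filter P? xs) ≡ listSum (λ x → ⟨ P? x ⟩ * f x) xs
  listSum-filter P? f []       = refl
  listSum-filter P? f (x ∷ xs) with does (P? x)
  ... | true  = cong₂ _+_ (sym (+-identityʳ _)) (listSum-filter P? f xs)
  ... | false = listSum-filter P? f xs

  length-filter : ∀ {P : Pred A 0ℓ} (P? : Decidable P) xs → length (filter P? xs) ≡ listSum (λ x → ⟨ P? x ⟩) xs
  length-filter P? xs = trans (length-listSum (filter P? xs)) (trans (listSum-filter P? _ xs)
    (listSum-cong (λ x → *-identityʳ _) xs))

listSum-tabulate : ∀ {A : Set} {n} (f : A → ℕ) (g : Fin n → A) → listSum f (tabulate g) ≡ sum (λ i → f (g i))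
listSum-tabulate {n = zero}  f g = refl
listSum-tabulate {n = suc n} f g = cong (f (g zero) +_) (listSum-tabulate f (g ∘ suc))

listSum-allFin : ∀ {n} (f : Fin n → ℕ) → listSum f (allFin n) ≡ sum f
listSum-allFin f = listSum-tabulate f id

listSum-× : ∀ {A B : Set} (f : A × B → ℕ) xs ys →
  listSum f (cartesianProduct xs ys) ≡ listSum (λ x → listSum (λ y → f (x , y)) ys) xs
listSum-× f []       ys = refl
listSum-× f (x ∷ xs) ys = begin
  listSum f (map (x ,_) ys ++ cartesianProduct xs ys)
    ≡⟨ cong List.sum (map-++ f (map (x ,_) ys) _) ⟩
  List.sum (map f (map (x ,_) ys) ++ map f (cartesianProduct xs ys))
    ≡⟨ sum-++ (map f (map (x ,_) ys)) _ ⟩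
  List.sum (map f (map (x ,_) ys)) + listSum f (cartesianProduct xs ys)
    ≡⟨ cong₂ _+_ (cong List.sum (sym (map-∘ ys))) (listSum-× f xs ys) ⟩
  listSum (λ y → f (x , y)) ys + listSum (λ x → listSum (λ y → f (x , y)) ys) xs ∎
  where open ≡-Reasoning

sum-mono : ∀ {n} {f g : Fin n → ℕ} → (∀ i → f i ≤ g i) → sum f ≤ sum g
sum-mono {zero}  f≤g = z≤n
sum-mono {suc n} f≤g = +-mono-≤ (f≤g zero) (sum-mono (f≤g ∘ suc))

sum-delta : ∀ {n} (x : Fin n) (f : Fin n → ℕ) → sum (λ u → ⟨ x Fin.≟ u ⟩ * f u) ≡ f x
sum-delta {suc n} zero f = trans (cong₂ _+_ (+-identityʳ _) (sum-replicate-zero n)) (+-identityʳ _)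
sum-delta (suc x) f = sum-delta x (f ∘ suc)

module _ {n : ℕ} where

  sum² : (Fin n → Fin n → ℕ) → ℕ
  sum² f = sum λ u → sum λ v → f u v

  sum³ : (Fin n → Fin n → Fin n → ℕ) → ℕ
  sum³ f = sum λ u → sum² (f u)

  sum²-cong : ∀ {f g} → (∀ u v → f u v ≡ g u v) → sum² f ≡ sum² g
  sum²-cong eq = sum-cong-≗ λ u → sum-cong-≗ (eq u)

  sum²-+ : ∀ f g → sum² (λ u v → f u v + g u v) ≡ sum² f + sum² g
  sum²-+ f g = trans (sum-cong-≗ λ u → ∑-distrib-+ (f u) (g u)) (∑-distrib-+ (sum ∘ f) (sum ∘ g))

  sum³-cong : ∀ {f g} → (∀ u v w → f u v w ≡ g u v w) → sum³ f ≡ sum³ g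
  sum³-cong eq = sum-cong-≗ λ u → sum²-cong (eq u)

  sum³-+ : ∀ f g → sum³ (λ u v w → f u v w + g u v w) ≡ sum³ f + sum³ g
  sum³-+ f g = trans (sum-cong-≗ λ u → sum²-+ (f u) (g u)) (∑-distrib-+ (sum² ∘ f) (sum² ∘ g))

  listSum-pairs : ∀ f → listSum f (cartesianProduct (allFin n) (allFin n)) ≡ sum² λ u v → f (u , v)
  listSum-pairs f = trans (listSum-× f (allFin n) (allFin n)) (trans (listSum-allFin {n} _)
    (sum-cong-≗ λ u → listSum-allFin λ v → f (u , v)))

  listSum-triples : ∀ f → listSum f (cartesianProduct (allFin n) (cartesianProduct (allFin n) (allFin n))) ≡
                    sum³ λ u v w → f (u , v , w)
  listSum-triples f = trans (listSum-× f (allFin n) _) (trans (listSum-allFin {n} _)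
    (sum-cong-≗ λ u → listSum-pairs λ (v , w) → f (u , v , w)))

  lt : Fin n → Fin n → ℕ
  lt u v = ⟨ u Fin.<? v ⟩

  lt-irrefl : ∀ u → lt u u ≡ 0
  lt-irrefl u = ⟨⟩-no (u Fin.<? u) (<-irrefl refl)

  lt-total : ∀ u v → u ≡ v ⊎ (lt u v ≡ 1 × lt v u ≡ 0) ⊎ (lt u v ≡ 0 × lt v u ≡ 1)
  lt-total u v with Fin.<-cmp u v
  ... | tri< u<v _ v≮u = inj₂ (inj₁ (⟨⟩-yes (u Fin.<? v) u<v , ⟨⟩-no (v Fin.<? u) v≮u))
  ... | tri≈ _ u≡v _   = inj₁ u≡v
  ... | tri> u≮v _ v<u = inj₂ (inj₂ (⟨⟩-no (u Fin.<? v) u≮v , ⟨⟩-yes (v Fin.<? u) v<u))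

  lt⇒< : ∀ u v → lt u v ≡ 1 → u Fin.< v
  lt⇒< u v = ⟨⟩-holds (u Fin.<? v)

  lt-trans : ∀ u v w → lt u v ≡ 1 → lt v w ≡ 1 → lt u w ≡ 1
  lt-trans u v w p q = ⟨⟩-yes (u Fin.<? w) (<-trans (lt⇒< u v p) (lt⇒< v w q))

  lt-asym : ∀ u v → lt u v ≡ 1 → lt v u ≡ 0
  lt-asym u v p = ⟨⟩-no (v Fin.<? u) (<-asym (lt⇒< u v p))

  -- Off the diagonal exactly one of u < v and v < u holds, and exchanging the order of summation
  -- identifies the two halves.
  sum²-symmetric : ∀ s → (∀ u v → s u v ≡ s v u) → (∀ u → s u u ≡ 0) →
                   sum² s ≡ 2 * sum² λ u v → lt u v * s u v
  sum²-symmetric s s-sym s-diag = begin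
    sum² s
      ≡⟨ sum²-cong split ⟩
    sum² (λ u v → lt u v * s u v + lt v u * s v u)
      ≡⟨ sum²-+ (λ u v → lt u v * s u v) (λ u v → lt v u * s v u) ⟩
    half + sum² (λ u v → lt v u * s v u)
      ≡⟨ cong (half +_) (trans (sym (∑-comm λ u v → lt u v * s u v)) (sym (+-identityʳ half))) ⟩
    half + (half + 0) ∎
    where
    open ≡-Reasoning
    half : ℕ
    half = sum² λ u v → lt u v * s u v
    split : ∀ u v → s u v ≡ lt u v * s u v + lt v u * s v u
    split u v with lt-total u v
    ... | inj₁ refl rewrite s-diag u | *-zeroʳ (lt u u) = refl
    ... | inj₂ (inj₁ (p , q)) rewrite p | q = sym (trans (+-identityʳ _) (+-identityʳ _))
    ... | inj₂ (inj₂ (p , q)) rewrite p | q = trans (s-sym u v) (sym (+-identityʳ _))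

-- Triangles

module Counting {n : ℕ} (G : Graph n) where
  open Graph G renaming (sym to E-sym; irrefl to E-irrefl)

  e : Fin n → Fin n → ℕ
  e u v = ⟨ E? u v ⟩

  e-sym : ∀ u v → e u v ≡ e v u
  e-sym u v = ⟨⟩-⇔ (E? u v) (E? v u) E-sym E-sym

  e-irrefl : ∀ u → e u u ≡ 0
  e-irrefl u = ⟨⟩-no (E? u u) (E-irrefl refl)

  degree : Fin n → ℕ
  degree v = sum (e v)

  handshake : sum degree ≡ ∣E∣ G + ∣E∣ G
  handshake = begin
    sum² e                            ≡⟨ sum²-symmetric e e-sym e-irrefl ⟩
    2 * sum² (λ u v → lt u v * e u v) ≡⟨ cong (2 *_) (sym edges≡) ⟩
    2 * ∣E∣ G                         ≡⟨ cong (∣E∣ G +_) (+-identityʳ _) ⟩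
    ∣E∣ G + ∣E∣ G                     ∎
    where
    open ≡-Reasoning
    edges≡ : ∣E∣ G ≡ sum² λ u v → lt u v * e u v
    edges≡ = trans (length-filter (λ (u , v) → u Fin.<? v ×-dec E? u v) (cartesianProduct (allFin n) (allFin n)))
      (trans (listSum-pairs {n} _) (sum²-cong λ u v → ⟨⟩-× (u Fin.<? v) (E? u v)))

  common : Fin n → Fin n → ℕ
  common u v = sum λ w → e u w * e v w

  common-sym : ∀ u v → common u v ≡ common v u
  common-sym u v = sum-cong-≗ λ w → *-comm (e u w) (e v w)

  Triple : Pred (Fin n × Fin n × Fin n) 0ℓ
  Triple (u , v , w) = (u Fin.< v × v Fin.< w) × (E u v × E v w × E u w)

  triple? : Decidable Triple
  triple? (u , v , w) = (u Fin.<? v ×-dec v Fin.<? w) ×-dec (E? u v ×-dec E? v w ×-dec E? u w)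

  t : Fin n → Fin n → Fin n → ℕ
  t u v w = (lt u v * lt v w) * (e u v * (e v w * e u w))

  ⟨triple⟩ : ∀ u v w → ⟨ triple? (u , v , w) ⟩ ≡ t u v w
  ⟨triple⟩ u v w = trans (⟨⟩-× (u Fin.<? v ×-dec v Fin.<? w) (E? u v ×-dec E? v w ×-dec E? u w))
    (cong₂ _*_ (⟨⟩-× (u Fin.<? v) (v Fin.<? w))
      (trans (⟨⟩-× (E? u v) (E? v w ×-dec E? u w)) (cong (e u v *_) (⟨⟩-× (E? v w) (E? u w)))))

  △G-sum : △G G ≡ sum³ t
  △G-sum = trans (length-filter triple? (cartesianProduct (allFin n) (cartesianProduct (allFin n) (allFin n)))) (trans (listSum-triples {n} _) (sum³-cong ⟨triple⟩))

  -- An increasing triple contains x in at most one position, so the disjunction turns into a sum of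
  -- three brackets. Where two positions coincide, `t` vanishes by irreflexivity of the order or of
  -- E.
  △-sum : ∀ x → △ G x ≡ sum² (t x) + (sum² (λ a b → t a x b) + sum² (λ a b → t a b x))
  △-sum x = begin
    △ G x
      ≡⟨ length-filter contains? (triangles G) ⟩
    listSum (λ y → ⟨ contains? y ⟩) (triangles G)
      ≡⟨ listSum-filter triple? (λ y → ⟨ contains? y ⟩) (cartesianProduct (allFin n) (cartesianProduct (allFin n) (allFin n))) ⟩
    listSum (λ y → ⟨ triple? y ⟩ * ⟨ contains? y ⟩) (cartesianProduct (allFin n) (cartesianProduct (allFin n) (allFin n)))
      ≡⟨ listSum-triples {n} _ ⟩
    sum³ (λ u v w → ⟨ triple? (u , v , w) ⟩ * ⟨ contains? (u , v , w) ⟩)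
      ≡⟨ sum³-cong (λ u v w → trans (cong (_* ⟨ contains? (u , v , w) ⟩) (⟨triple⟩ u v w)) (split u v w)) ⟩
    sum³ (λ u v w → eq u * t u v w + (eq v * t u v w + eq w * t u v w))
      ≡⟨ sum³-+ (λ u v w → eq u * t u v w) (λ u v w → eq v * t u v w + eq w * t u v w) ⟩
    sum³ (λ u v w → eq u * t u v w) + sum³ (λ u v w → eq v * t u v w + eq w * t u v w)
      ≡⟨ cong₂ _+_ first (trans (sum³-+ (λ u v w → eq v * t u v w) (λ u v w → eq w * t u v w)) (cong₂ _+_ second third)) ⟩
    sum² (t x) + (sum² (λ a b → t a x b) + sum² (λ a b → t a b x)) ∎
    where
    open ≡-Reasoning
    contains? : Decidable λ ((u , v , w) : Fin n × Fin n × Fin n) → x ≡ u ⊎ x ≡ v ⊎ x ≡ w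
    contains? (u , v , w) = x Fin.≟ u ⊎-dec x Fin.≟ v ⊎-dec x Fin.≟ w
    eq : Fin n → ℕ
    eq u = ⟨ x Fin.≟ u ⟩
    split : ∀ u v w → t u v w * ⟨ contains? (u , v , w) ⟩ ≡ eq u * t u v w + (eq v * t u v w + eq w * t u v w)
    split u v w with x Fin.≟ u | x Fin.≟ v | x Fin.≟ w
    ... | yes refl | yes refl | d rewrite lt-irrefl x = sym (*-zeroʳ ⟨ d ⟩)
    ... | yes refl | no _ | yes refl rewrite e-irrefl x | *-zeroʳ (e v x) | *-zeroʳ (e x v)
        | *-zeroʳ (lt x v * lt v x) = refl
    ... | yes refl | no _ | no _ = trans (*-identityʳ _) (sym (trans (+-identityʳ _) (+-identityʳ _)))
    ... | no _ | yes refl | yes refl rewrite lt-irrefl x | *-zeroʳ (lt u x) = refl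
    ... | no _ | yes refl | no _ = trans (*-identityʳ _) (sym (trans (+-identityʳ _) (+-identityʳ _)))
    ... | no _ | no _ | yes refl = trans (*-identityʳ _) (sym (+-identityʳ _))
    ... | no _ | no _ | no _ = *-zeroʳ (t u v w)
    first : sum³ (λ u v w → eq u * t u v w) ≡ sum² (t x)
    first = trans (sum-cong-≗ λ u → trans
        (sum-cong-≗ λ v → sym (*-distribˡ-sum (eq u) (t u v))) (sym (*-distribˡ-sum (eq u) (sum ∘ t u))))
      (sum-delta x (sum² ∘ t))
    second : sum³ (λ u v w → eq v * t u v w) ≡ sum² (λ a b → t a x b)
    second = sum-cong-≗ λ u → trans (sum-cong-≗ λ v → sym (*-distribˡ-sum (eq v) (t u v))) (sum-delta x (sum ∘ t u))
    third : sum³ (λ u v w → eq w * t u v w) ≡ sum² (λ a b → t a b x)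
    third = sum²-cong λ u v → sum-delta x (t u v)

  △G-△ : sum (△ G) ≡ 3 * △G G
  △G-△ = begin
    sum (△ G)
      ≡⟨ sum-cong-≗ △-sum ⟩
    sum (λ x → sum² (t x) + (sum² (λ a b → t a x b) + sum² (λ a b → t a b x)))
      ≡⟨ ∑-distrib-+ (λ x → sum² (t x)) _ ⟩
    sum³ t + sum (λ x → sum² (λ a b → t a x b) + sum² (λ a b → t a b x))
      ≡⟨ cong (sum³ t +_) (∑-distrib-+ (λ x → sum² λ a b → t a x b) _) ⟩
    sum³ t + (sum³ (λ x a b → t a x b) + sum³ (λ x a b → t a b x))
      ≡⟨ cong (sum³ t +_) (cong₂ _+_ (∑-comm λ x a → sum (t a x))
           (trans (∑-comm λ x a → sum λ b → t a b x) (sum-cong-≗ λ a → ∑-comm λ x b → t a b x))) ⟩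
    sum³ t + (sum³ t + sum³ t)
      ≡⟨ cong₂ _+_ (sym △G-sum) (cong₂ _+_ (sym △G-sum) (trans (sym △G-sum) (sym (+-identityʳ _)))) ⟩
    3 * △G G ∎
    where open ≡-Reasoning

  -- The left side counts the ordered pairs (a , b) of adjacent neighbours of x, hence each triangle
  -- at x twice. Symmetry reduces it to a < b, and then x takes one of the three positions in the
  -- increasing triple.
  △-common : ∀ x → sum (λ a → e x a * common x a) ≡ 2 * △ G x
  △-common x = begin
    sum (λ a → e x a * common x a)
      ≡⟨ sum-cong-≗ (λ a → *-distribˡ-sum (e x a) (λ b → e x b * e a b)) ⟩
    sum² s
      ≡⟨ sum²-symmetric s s-sym s-diag ⟩
    2 * sum² (λ a b → lt a b * s a b)
      ≡⟨ cong (2 *_) (trans (sym (sum²-cong merge)) (trans (sum²-+ (t x) _)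
           (trans (cong (sum² (t x) +_) (sum²-+ (λ a b → t a x b) (λ a b → t a b x))) (sym (△-sum x))))) ⟩
    2 * △ G x ∎
    where
    open ≡-Reasoning
    s : Fin n → Fin n → ℕ
    s a b = e x a * (e x b * e a b)
    s-sym : ∀ a b → s a b ≡ s b a
    s-sym a b rewrite e-sym b a = swap (e x a) (e x b) (e a b)
      where
      swap : ∀ p q r → p * (q * r) ≡ q * (p * r)
      swap = solve-∀
    s-diag : ∀ a → s a a ≡ 0
    s-diag a rewrite e-irrefl a | *-zeroʳ (e x a) = *-zeroʳ (e x a)
    -- If x is a or b, then `s a b` is 0; otherwise a < b leaves exactly one of x < a < b, a < x < b
    -- and a < b < x.
    order : ∀ a b → (lt x a * lt a b + (lt a x * lt x b + lt a b * lt b x)) * s a b ≡ lt a b * s a b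
    order a b with lt-total x a | lt-total x b
    ... | inj₁ refl | _ rewrite e-irrefl x = trans (*-zeroʳ (lt x x * lt x b + (lt x x * lt x b + lt x b * lt b x))) (sym (*-zeroʳ (lt x b)))
    ... | inj₂ _ | inj₁ refl rewrite e-irrefl x | *-zeroʳ (e x a) = trans (*-zeroʳ (lt x a * lt a x + (lt a x * lt x x + lt a x * lt x x))) (sym (*-zeroʳ (lt a x)))
    ... | inj₂ (inj₁ (p , q)) | inj₂ (inj₁ (p′ , q′)) rewrite p | q | q′ =
      cong (_* s a b) (identity (lt a b))
      where
      identity : ∀ k → k + 0 + k * 0 ≡ k
      identity = solve-∀
    ... | inj₂ (inj₁ (p , q)) | inj₂ (inj₂ (p′ , q′)) rewrite lt-asym b a (lt-trans b x a q′ p) | p | q = refl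
    ... | inj₂ (inj₂ (p , q)) | inj₂ (inj₁ (p′ , q′)) rewrite lt-trans a x b q p′ | p | q | p′ | q′ = refl
    ... | inj₂ (inj₂ (p , q)) | inj₂ (inj₂ (p′ , q′)) rewrite p | q | p′ | q′ =
      cong (_* s a b) (*-identityʳ (lt a b))
    merge : ∀ a b → t x a b + (t a x b + t a b x) ≡ lt a b * s a b
    merge a b = trans (regroup (lt x a) (lt a x) (lt a b) (lt x b) (lt b x) (e x a) (e x b) (e a b)
        (e a x) (e b x) (e-sym a x) (e-sym b x)) (order a b)
      where
      regroup′ : ∀ xa ax ab xb bx p q r → (xa * ab) * (p * (r * q)) + ((ax * xb) * (p * (q * r)) + (ab * bx) * (r * (q * p)))
                 ≡ (xa * ab + (ax * xb + ab * bx)) * (p * (q * r))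
      regroup′ = solve-∀
      regroup : ∀ xa ax ab xb bx p q r p′ q′ → p′ ≡ p → q′ ≡ q →
        (xa * ab) * (p * (r * q)) + ((ax * xb) * (p′ * (q * r)) + (ab * bx) * (r * (q′ * p′)))
        ≡ (xa * ab + (ax * xb + ab * bx)) * (p * (q * r))
      regroup xa ax ab xb bx p q r _ _ refl refl = regroup′ xa ax ab xb bx p q r

-- The input as an array of arcs

contents-++ˡ : ∀ {n} (xs ys : List (Fin n)) k → contents (map toℕ (xs ++ ys)) (toℕ k) ≡ toℕ (lookup xs k)
contents-++ˡ (x ∷ xs) ys zero    = refl
contents-++ˡ (x ∷ xs) ys (suc k) = contents-++ˡ xs ys k

contents-++ʳ : ∀ {n} (xs ys : List (Fin n)) j → contents (map toℕ (xs ++ ys)) (length xs + j) ≡ contents (map toℕ ys) j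
contents-++ʳ []       ys j = refl
contents-++ʳ (x ∷ xs) ys j = contents-++ʳ xs ys j

contents-scanl : ∀ {m} a (g : Fin m → ℕ) v → let s = contents (scanl _+_ a (tabulate g)) in
                 s (suc (toℕ v)) ≡ s (toℕ v) + g v
contents-scanl a g zero    = refl
contents-scanl a g (suc v) = contents-scanl (a + g zero) (g ∘ suc) v

-- The position `o` is the total length of the earlier lists. The accumulator `a` is kept general
-- for the induction, which moves the first length into it.
contents-segment : ∀ {m n} a (f : Fin m → List (Fin n)) v → ∃[ o ]
  contents (scanl _+_ a (tabulate (length ∘ f))) (toℕ v) ≡ a + o ×
  (∀ k → contents (map toℕ (concat (tabulate f))) (o + toℕ k) ≡ toℕ (lookup (f v) k))
contents-segment a f zero = 0 , sym (+-identityʳ a) , contents-++ˡ (f zero) _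
contents-segment a f (suc v) with contents-segment (a + length (f zero)) (f ∘ suc) v
... | o , start , segment = length (f zero) + o , trans start (+-assoc a _ o) , λ k → trans
  (cong (contents (map toℕ (f zero ++ concat (tabulate (f ∘ suc))))) (+-assoc (length (f zero)) o (toℕ k)))
  (trans (contents-++ʳ (f zero) _ (o + toℕ k)) (segment k))

telescope : ∀ m (h : ℕ → ℕ) → (∀ k → k < m → h k ≤ h (suc k)) →
            h m ≡ h 0 + sum {m} λ v → h (suc (toℕ v)) ∸ h (toℕ v)
telescope zero    h mono = sym (+-identityʳ _)
telescope (suc m) h mono = trans (telescope m (h ∘ suc) λ k k<m → mono (suc k) (s≤s k<m))
  (trans (cong (_+ rest) (sym (m+[n∸m]≡n (mono 0 (s≤s z≤n))))) (+-assoc (h 0) (h 1 ∸ h 0) rest))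
  where
  rest : ℕ
  rest = sum {m} λ v → h (suc (suc (toℕ v))) ∸ h (suc (toℕ v))

monotone-step : ∀ (h : ℕ → ℕ) n → (∀ k → k < n → h k ≤ h (suc k)) → Monotone h n
monotone-step h n step {j} {k} j≤k k≤n with ≤⇒≤′ j≤k
... | ≤′-refl              = ≤-refl
... | ≤′-step {n = k} j≤′k = ≤-trans (monotone-step h n step (≤′⇒≤ j≤′k) (<⇒≤ k≤n)) (step k k≤n)

prefix-list : ∀ {A : Set} (h : A → ℕ) xs f → (∀ k → f (toℕ k) ≡ h (lookup xs k)) → prefix f (length xs) ≡ listSum h xs
prefix-list h []       f eq = refl
prefix-list h (x ∷ xs) f eq = trans (prefix-+ f 1 (length xs))
  (cong₂ _+_ (eq zero) (prefix-list h xs (f ∘ suc) (eq ∘ suc)))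

unique-lookup : ∀ {A : Set} {xs : List A} → Unique xs → ∀ j k → lookup xs j ≡ lookup xs k → j ≡ k
unique-lookup (x ∷ u) zero    zero    eq = refl
unique-lookup (x ∷ u) zero    (suc k) eq = contradiction eq (All.lookup x (∈-lookup k))
unique-lookup (x ∷ u) (suc j) zero    eq = contradiction (sym eq) (All.lookup x (∈-lookup j))
unique-lookup (x ∷ u) (suc j) (suc k) eq = cong suc (unique-lookup u j k eq)

module Layout {n : ℕ} (G : Graph n) (𝓛 : AdjacencyLists G) where
  open Graph G using (E; E?)
  open AdjacencyLists 𝓛 renaming (adj to neighbours)
  open Counting G

  L : ℕ
  L = ∣E∣ G + ∣E∣ G

  off tgt src : ℕ → ℕ
  off = input G 𝓛 1
  tgt = input G 𝓛 2
  src = locate off n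

  adj : ℕ → ℕ → ℕ
  adj x w with x <? n | w <? n
  ... | yes x<n | yes w<n = e (fromℕ< x<n) (fromℕ< w<n)
  ... | _       | _       = 0

  open Quantities L off tgt src adj

  adj≡ : ∀ x w → adj (toℕ x) (toℕ w) ≡ e x w
  adj≡ x w with toℕ x <? n | toℕ w <? n
  ... | yes x<n | yes w<n = cong₂ e (Fin.fromℕ<-toℕ x x<n) (Fin.fromℕ<-toℕ w w<n)
  ... | no x≮n  | _       = contradiction (Fin.toℕ<n x) x≮n
  ... | yes _   | no w≮n  = contradiction (Fin.toℕ<n w) w≮n

  listSum-neighbours : ∀ v (h : Fin n → ℕ) → listSum h (neighbours v) ≡ sum λ u → e v u * h u
  listSum-neighbours v h = trans (sum-↭ (map⁺ h (correct v)))
    (trans (listSum-filter (N? G v) h (allFin n)) (listSum-allFin λ u → e v u * h u))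

  length-neighbours : ∀ v → length (neighbours v) ≡ degree v
  length-neighbours v = trans (length-listSum (neighbours v)) (trans (listSum-neighbours v _)
    (sum-cong-≗ λ u → *-identityʳ (e v u)))

  off-suc : ∀ v → off (suc (toℕ v)) ≡ off (toℕ v) + length (neighbours v)
  off-suc = contents-scanl 0 (length ∘ neighbours)

  deg≡length : ∀ v → deg (toℕ v) ≡ length (neighbours v)
  deg≡length v = trans (cong (_∸ off (toℕ v)) (off-suc v)) (m+n∸m≡n (off (toℕ v)) _)

  deg≡ : ∀ v → deg (toℕ v) ≡ degree v
  deg≡ v = trans (deg≡length v) (length-neighbours v)

  off-step : ∀ k → k < n → off k ≤ off (suc k)
  off-step k k<n = subst (λ k → off k ≤ off (suc k)) (Fin.toℕ-fromℕ< k<n)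
    (subst (off (toℕ v) ≤_) (sym (off-suc v)) (m≤m+n _ _))
    where v = fromℕ< k<n

  off-mono : Monotone off n
  off-mono = monotone-step off n off-step

  off-last : off n ≡ L
  off-last = trans (telescope n off off-step) (trans (sum-cong-≗ deg≡) handshake)

  src-between : ∀ {a} → a < L → Between off n a (src a)
  src-between a<L = locate-between off n z≤n (subst (_ <_) (sym off-last) a<L)

  -- Coordinates for arcs: the k-th entry in the list of v. By `arcAt-surjective` every arc has this
  -- form, and facts about arcs become facts about list lookups.
  arcAt : ∀ v → Fin (length (neighbours v)) → ℕ
  arcAt v k = off (toℕ v) + toℕ k

  tgt-arcAt : ∀ v k → tgt (arcAt v k) ≡ toℕ (lookup (neighbours v) k)
  tgt-arcAt v k with contents-segment 0 neighbours v
  ... | o , start , segment = trans (cong (λ o → tgt (o + toℕ k)) start) (segment k)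

  arcAt-between : ∀ v k → Between off n (arcAt v k) (toℕ v)
  arcAt-between v k = between (Fin.toℕ<n v) (m≤m+n _ _)
    (subst (arcAt v k <_) (sym (off-suc v)) (+-monoʳ-< (off (toℕ v)) (Fin.toℕ<n k)))

  arcAt<L : ∀ v k → arcAt v k < L
  arcAt<L v k = <-≤-trans (Between.upper (arcAt-between v k)) (subst (off (suc (toℕ v)) ≤_) off-last (off-mono (Fin.toℕ<n v) ≤-refl))

  src-arcAt : ∀ v k → src (arcAt v k) ≡ toℕ v
  src-arcAt v k = between-unique off-mono (src-between (arcAt<L v k)) (arcAt-between v k)

  arcAt-surjective : ∀ {a} → a < L → ∃[ v ] ∃[ k ] a ≡ arcAt v k
  arcAt-surjective {a} a<L = v , fromℕ< j< , sym (trans (cong₂ _+_ (cong off v≡) (Fin.toℕ-fromℕ< j<)) (m+[n∸m]≡n lower))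
    where
    open Between (src-between a<L)
    v = fromℕ< v<n
    v≡ : toℕ v ≡ src a
    v≡ = Fin.toℕ-fromℕ< v<n
    j< : a ∸ off (src a) < length (neighbours v)
    j< = subst (a ∸ off (src a) <_) (trans (cong deg (sym v≡)) (deg≡length v)) (∸-monoˡ-< upper lower)

  unique-neighbours : ∀ v → Unique (neighbours v)
  unique-neighbours v = Permutation.Unique-resp-↭ (setoid (Fin n)) (↭⇒↭ₛ (↭-sym (correct v)))
    (Unique.filter⁺ (N? G v) (Unique.allFin⁺ n))

  lookup-E : ∀ v k → E v (lookup (neighbours v) k)
  lookup-E v k = proj₂ (∈-filter⁻ (N? G v) {xs = allFin n} (∈-resp-↭ (correct v) (∈-lookup k)))

  E-lookup : ∀ {v u} → E v u → ∃[ k ] u ≡ lookup (neighbours v) k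
  E-lookup {v} {u} Evu = index u∈ , lookup-index u∈
    where
    u∈ : u ∈ neighbours v
    u∈ = ∈-resp-↭ (↭-sym (correct v)) (∈-filter⁺ (N? G v) (∈-allFin u) Evu)

  for-arcs : ∀ (P : ℕ → Set) → (∀ v k → P (arcAt v k)) → ∀ {a} → a < L → P a
  for-arcs P h a<L = let v , k , a≡ = arcAt-surjective a<L in subst P (sym a≡) (h v k)

  arcAt-simple : ∀ v w j k → src (arcAt v j) ≡ src (arcAt w k) → tgt (arcAt v j) ≡ tgt (arcAt w k) → arcAt v j ≡ arcAt w k
  arcAt-simple v w j k s≡ t≡ = same
    (Fin.toℕ-injective (trans (sym (src-arcAt v j)) (trans s≡ (src-arcAt w k)))) j k
    (Fin.toℕ-injective (trans (sym (tgt-arcAt v j)) (trans t≡ (tgt-arcAt w k))))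
    where
    same : ∀ {v w} → v ≡ w → ∀ j k → lookup (neighbours v) j ≡ lookup (neighbours w) k → arcAt v j ≡ arcAt w k
    same {v} refl j k eq = cong (arcAt v) (unique-lookup (unique-neighbours v) j k eq)

  Adjacency : ℕ → ℕ → Set
  Adjacency x w = (adj x w ≡ 1 × ∃[ a ] a < L × src a ≡ x × tgt a ≡ w) ⊎
                  (adj x w ≡ 0 × (∀ a → a < L → ¬ (src a ≡ x × tgt a ≡ w)))

  adjacency : ∀ x w → Dec (E x w) → Adjacency (toℕ x) (toℕ w)
  adjacency x w (yes Exw) = let k , w≡ = E-lookup Exw in
    inj₁ (trans (adj≡ x w) (⟨⟩-yes (E? x w) Exw)
         , arcAt x k , arcAt<L x k , src-arcAt x k , trans (tgt-arcAt x k) (cong toℕ (sym w≡)))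
  adjacency x w (no ¬Exw) = inj₂ (trans (adj≡ x w) (⟨⟩-no (E? x w) ¬Exw) , λ a →
    for-arcs (λ a → ¬ (src a ≡ toℕ x × tgt a ≡ toℕ w)) λ { v k (s≡ , t≡) → ¬Exw (subst₂ E
      (Fin.toℕ-injective (trans (sym (src-arcAt v k)) s≡))
      (Fin.toℕ-injective (trans (sym (tgt-arcAt v k)) t≡)) (lookup-E v k)) })

  arcs : Arcs n L off tgt src adj
  arcs = record
    { off-mono    = off-mono
    ; off-last    = off-last
    ; src-between = src-between
    ; tgt<n       = for-arcs (λ a → tgt a < n) λ v k → subst (_< n) (sym (tgt-arcAt v k)) (Fin.toℕ<n _)
    ; simple      = λ a<L b<L → for-arcs (λ a → ∀ {b} → b < L → src a ≡ src b → tgt a ≡ tgt b → a ≡ b)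
        (λ v j → for-arcs (λ b → src (arcAt v j) ≡ src b → tgt (arcAt v j) ≡ tgt b → arcAt v j ≡ b)
          λ w k → arcAt-simple v w j k) a<L b<L
    ; adjacent    = λ x<n w<n → subst₂ Adjacency (Fin.toℕ-fromℕ< x<n) (Fin.toℕ-fromℕ< w<n)
        (adjacency (fromℕ< x<n) (fromℕ< w<n) (E? _ _))
    }

  at-vertex-sum : ∀ (f : ℕ → ℕ) (h : Fin n → ℕ) v →
    (∀ k → f (arcAt v k) ≡ h (lookup (neighbours v) k)) → at-vertex f (toℕ v) ≡ sum λ u → e v u * h u
  at-vertex-sum f h v eq = begin
    prefix f (off (suc (toℕ v))) ∸ prefix f (off (toℕ v))
      ≡⟨ cong (λ x → prefix f x ∸ prefix f (off (toℕ v))) (off-suc v) ⟩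
    prefix f (off (toℕ v) + length (neighbours v)) ∸ prefix f (off (toℕ v))
      ≡⟨ cong (_∸ prefix f (off (toℕ v))) (prefix-+ f (off (toℕ v)) _) ⟩
    prefix f (off (toℕ v)) + prefix (λ j → f (off (toℕ v) + j)) (length (neighbours v)) ∸ prefix f (off (toℕ v))
      ≡⟨ m+n∸m≡n (prefix f (off (toℕ v))) _ ⟩
    prefix (λ j → f (off (toℕ v) + j)) (length (neighbours v))
      ≡⟨ prefix-list h (neighbours v) _ eq ⟩
    listSum h (neighbours v)
      ≡⟨ listSum-neighbours v h ⟩
    sum (λ u → e v u * h u) ∎
    where open ≡-Reasoning

  prefix-total : ∀ f → prefix f L ≡ sum λ (v : Fin n) → at-vertex f (toℕ v)
  prefix-total f = trans (cong (prefix f) (sym off-last)) (telescope n (prefix f ∘ off) λ k k<n → prefix-mono f {off k} {off (suc k)} (off-step k k<n))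

  adj-row : ∀ y x → prefix (λ j → adj (toℕ x) (tgt (off (toℕ y) + j))) (deg (toℕ y)) ≡ common y x
  adj-row y x = trans (cong (prefix row) (deg≡length y))
    (trans (prefix-list (e x) (neighbours y) row λ k → trans (cong (adj (toℕ x)) (tgt-arcAt y k)) (adj≡ x _))
           (listSum-neighbours y (e x)))
    where
    row : ℕ → ℕ
    row j = adj (toℕ x) (tgt (off (toℕ y) + j))

  -- The number of tests is the degree of the endpoint whose list is scanned, so the list is scanned
  -- completely. If that endpoint is the target, symmetry of `common` gives the same count.
  c-common : ∀ a v u → src a ≡ toℕ v → tgt a ≡ toℕ u → c a ≡ common v u
  c-common a v u s≡ t≡ rewrite s≡ | t≡ with deg (toℕ v) ∸ deg (toℕ u) in ex
  ... | zero  rewrite m≤n⇒m⊓n≡m (m∸n≡0⇒m≤n {deg (toℕ v)} {deg (toℕ u)} ex) = adj-row v u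
  ... | suc _ rewrite m≥n⇒m⊓n≡n {deg (toℕ v)} {deg (toℕ u)} (<⇒≤ (m∸n≢0⇒n<m λ z → 1+n≢0 (trans (sym ex) z))) =
    trans (adj-row u v) (common-sym u v)

  c-arcAt : ∀ v k → c (arcAt v k) ≡ common v (lookup (neighbours v) k)
  c-arcAt v k = c-common (arcAt v k) v _ (src-arcAt v k) (tgt-arcAt v k)

  D-△ : ∀ v → D (toℕ v) ≡ 2 * △ G v
  D-△ v = trans (at-vertex-sum c (common v) v (c-arcAt v)) (△-common v)

  total-△ : prefix c L ≡ 6 * △G G
  total-△ = begin
    prefix c L                   ≡⟨ prefix-total c ⟩
    sum (λ (v : Fin n) → D (toℕ v))        ≡⟨ sum-cong-≗ D-△ ⟩
    sum (λ v → 2 * △ G v)        ≡⟨ sym (*-distribˡ-sum 2 (△ G)) ⟩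
    2 * sum (△ G)                ≡⟨ cong (2 *_) △G-△ ⟩
    2 * (3 * △G G)               ≡⟨ sym (*-assoc 2 3 (△G G)) ⟩
    6 * △G G                     ∎
    where open ≡-Reasoning

  num-△ : ∀ v → num (toℕ v) ≡ 2 * △ G v +
          sum λ u → e v u * (2 * △ G u + quot (2 * △ G u + 2 * △ G u) (1 ∸ common v u))
  num-△ v = cong₂ _+_ (D-△ v) (at-vertex-sum q (λ u → 2 * △ G u + quot (2 * △ G u + 2 * △ G u) (1 ∸ common v u)) v λ k →
    cong₂ (λ D c → D + quot (D + D) (1 ∸ c)) (trans (cong D (tgt-arcAt v k)) (D-△ _)) (c-arcAt v k))

  W-sum : prefix d L ≡ sum λ v → sum λ u → e v u * (degree v ⊓ degree u)
  W-sum = trans (prefix-total d) (sum-cong-≗ λ v → at-vertex-sum d (λ u → degree v ⊓ degree u) v λ k →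
    cong₂ _⊓_ (trans (cong deg (src-arcAt v k)) (deg≡ v)) (trans (cong deg (tgt-arcAt v k)) (deg≡ _)))

-- Resource bounds

-- The square root of k, rounded up.
root : ℕ → ℕ
root zero    = 0
root (suc k) with suc k ≤? root k * root k
... | yes _ = root k
... | no  _ = suc (root k)

-- When the root grows from r to r + 1, the failed test gives r² ≤ k, and r ≤ r² bounds the
-- increment. The factor 4 pays for the rounding.
root-bounds : ∀ k → k ≤ root k * root k × root k * root k ≤ 4 * k
root-bounds zero    = z≤n , z≤n
root-bounds (suc k) with suc k ≤? root k * root k | root-bounds k
... | yes k<r² | _ , r²≤4k = k<r² , ≤-trans r²≤4k (*-monoʳ-≤ 4 (n≤1+n k))
... | no  k≮r² | k≤r² , _  = s≤s (≤-trans k≤r² (≤-trans (*-monoʳ-≤ r (n≤1+n r)) (m≤n+m (r * suc r) r))) , upper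
  where
  r : ℕ
  r = root k
  r²≤k : r * r ≤ k
  r²≤k = s≤s⁻¹ (≰⇒> k≮r²)
  r≤r² : ∀ r → r ≤ r * r
  r≤r² zero    = z≤n
  r≤r² (suc r) = m≤m+n (suc r) _
  expand : ∀ r → suc r * suc r ≡ r * r + 2 * r + 1
  expand = solve-∀
  collect : ∀ k → k + 2 * k + 1 + (k + 3) ≡ 4 * suc k
  collect = solve-∀
  upper : suc r * suc r ≤ 4 * suc k
  upper = begin
    suc r * suc r         ≡⟨ expand r ⟩
    r * r + 2 * r + 1     ≤⟨ +-monoˡ-≤ 1 (+-mono-≤ r²≤k (*-monoʳ-≤ 2 (≤-trans (r≤r² r) r²≤k))) ⟩
    k + 2 * k + 1         ≤⟨ m≤m+n _ (k + 3) ⟩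
    k + 2 * k + 1 + (k + 3) ≡⟨ collect k ⟩
    4 * suc k             ∎
    where open ≤-Reasoning

sum-const-≤ : ∀ {n k} {f : Fin n → ℕ} → (∀ i → f i ≤ k) → sum f ≤ n * k
sum-const-≤ {zero}  f≤k = z≤n
sum-const-≤ {suc n} f≤k = +-mono-≤ (f≤k zero) (sum-const-≤ (f≤k ∘ suc))

term≤sum : ∀ {n} (f : Fin n → ℕ) i → f i ≤ sum f
term≤sum f zero    = m≤m+n (f zero) _
term≤sum f (suc i) = ≤-trans (term≤sum (f ∘ suc) i) (m≤n+m _ (f zero))

n<2^1+log : ∀ n → n < 2 ^ suc ⌊log₂ n ⌋
n<2^1+log n = ≰⇒> λ 2^≤n → <-irrefl refl
  (subst (_≤ ⌊log₂ n ⌋) (⌊log₂[2^n]⌋≡n (suc ⌊log₂ n ⌋)) (⌊log₂⌋-mono-≤ 2^≤n))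

module Bounds {n : ℕ} (G : Graph n) where
  open Graph G using (E; E?)
  open Counting G

  e≤1 : ∀ u v → e u v ≤ 1
  e≤1 u v with E? u v
  ... | yes _ = ≤-refl
  ... | no  _ = z≤n

  degree≤n : ∀ v → degree v ≤ n
  degree≤n v = ≤-trans (sum-const-≤ (e≤1 v)) (≤-reflexive (*-identityʳ n))

  minDegrees : ℕ
  minDegrees = sum λ v → sum λ u → e v u * (degree v ⊓ degree u)

  -- A crude bound is enough here: only its logarithm enters the running time.
  minDegrees≤n³ : minDegrees ≤ n * (n * n)
  minDegrees≤n³ = sum-const-≤ λ v → sum-const-≤ λ u → ≤-trans
    (*-mono-≤ (e≤1 v u) (≤-trans (m⊓n≤m _ _) (degree≤n v))) (≤-reflexive (+-identityʳ n))

  -- Split at the threshold s: a vertex of degree at most s contributes at most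
  -- s for each of its arcs, and there are at most s vertices of larger degree,
  -- whose neighbours have total degree at most sum degree.
  minDegrees-bound : ∀ s → 0 < s → sum degree ≤ s * s → minDegrees ≤ 2 * (sum degree * s)
  minDegrees-bound s 0<s ≤s² = begin
    minDegrees
      ≤⟨ sum-mono (λ v → sum-mono λ u → split v u) ⟩
    sum (λ v → sum λ u → e v u * s + heavy v * degree u)
      ≡⟨ sum²-+ (λ v u → e v u * s) (λ v u → heavy v * degree u) ⟩
    sum (λ v → sum λ u → e v u * s) + sum (λ v → sum λ u → heavy v * degree u)
      ≡⟨ cong₂ _+_ (trans (sum-cong-≗ λ v → sym (*-distribʳ-sum s (e v))) (sym (*-distribʳ-sum s degree)))
           (trans (sum-cong-≗ λ v → sym (*-distribˡ-sum (heavy v) degree)) (sym (*-distribʳ-sum (sum degree) heavy))) ⟩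
    sum degree * s + sum heavy * sum degree
      ≤⟨ +-monoʳ-≤ (sum degree * s) (*-monoˡ-≤ (sum degree) heavy≤s) ⟩
    sum degree * s + s * sum degree
      ≡⟨ cong (sum degree * s +_) (trans (*-comm s (sum degree)) (sym (+-identityʳ _))) ⟩
    2 * (sum degree * s) ∎
    where
    open ≤-Reasoning
    heavy : Fin n → ℕ
    heavy v = ⟨ s <? degree v ⟩
    split : ∀ v u → e v u * (degree v ⊓ degree u) ≤ e v u * s + heavy v * degree u
    split v u with s <? degree v
    ... | yes s<d rewrite ⟨⟩-yes (s <? degree v) s<d =
      ≤-trans (*-mono-≤ (e≤1 v u) (m⊓n≤n (degree v) (degree u))) (m≤n+m (1 * degree u) (e v u * s))
    ... | no  s≮d =
      ≤-trans (*-monoʳ-≤ (e v u) (≤-trans (m⊓n≤m (degree v) (degree u)) (≮⇒≥ s≮d))) (m≤m+n (e v u * s) _)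
    heavy-degree : ∀ v → heavy v * s ≤ degree v
    heavy-degree v = go (s <? degree v)
      where
      go : (h : Dec (s < degree v)) → ⟨ h ⟩ * s ≤ degree v
      go (yes s<d) = ≤-trans (≤-reflexive (+-identityʳ s)) (<⇒≤ s<d)
      go (no  _)   = z≤n
    -- Each heavy vertex accounts for at least s of the total degree, which is at most s²; then s is
    -- cancelled.
    heavy≤s : sum heavy ≤ s
    heavy≤s = *-cancelʳ-≤ (sum heavy) s s {{>-nonZero 0<s}} (begin
      sum heavy * s              ≡⟨ *-distribʳ-sum s heavy ⟩
      sum (λ v → heavy v * s)    ≤⟨ sum-mono heavy-degree ⟩
      sum degree                 ≤⟨ ≤s² ⟩
      s * s                      ∎)

-- Triangle centrality

-- Equality of unnormalised fractions is cross-multiplication. Matching `g` as a successor lets the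
-- division by it compute.
ratio : ∀ x y A B g .{{_ : NonZero g}} → x * (3 * g) ≡ (A + 3 * B) * suc y →
        mkℚᵘ (int x) y ≃ ((int 1 ℚ./ 3) ℚ.* (int A ℚ./ 1) ℚ.+ (int B ℚ./ 1)) ℚ.÷ (int g ℚ./ 1)
ratio x y A B (suc g) eq = *≡* (begin
  int x ℤ.* (int 3 ℤ.* int (suc g))
    ≡⟨ cong (int x ℤ.*_) (sym (ℤ.pos-* 3 (suc g))) ⟩
  int x ℤ.* int (3 * suc g)
    ≡⟨ sym (ℤ.pos-* x (3 * suc g)) ⟩
  int (x * (3 * suc g))
    ≡⟨ cong int eq ⟩
  int ((A + 3 * B) * suc y)
    ≡⟨ ℤ.pos-* (A + 3 * B) (suc y) ⟩
  (int A ℤ.+ int (3 * B)) ℤ.* int (suc y)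
    ≡⟨ cong (λ z → (int A ℤ.+ z) ℤ.* int (suc y)) (ℤ.pos-* 3 B) ⟩
  (int A ℤ.+ int 3 ℤ.* int B) ℤ.* int (suc y)
    ≡⟨ cong (ℤ._* int (suc y)) (rearrange (int A) (int B)) ⟩
  (int 1 ℤ.* int A ℤ.* int 1 ℤ.+ int B ℤ.* int 3) ℤ.* int 1 ℤ.* int (suc y) ∎)
  where
  open ≡-Reasoning
  rearrange : ∀ a b → a ℤ.+ int 3 ℤ.* b ≡ (int 1 ℤ.* a ℤ.* int 1 ℤ.+ b ℤ.* int 3) ℤ.* int 1
  rearrange = ℤ.solve-∀

module Centrality {n : ℕ} (G : Graph n) where
  open Graph G using (E; E?; irrefl)
  open Counting G

  ∑≡ : ∀ {P : Pred (Fin n) 0ℓ} (P? : Decidable P) f → ∑[ P? ] f ≡ sum λ u → ⟨ P? u ⟩ * f u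
  ∑≡ P? f = trans (listSum-filter P? f (allFin n)) (listSum-allFin λ u → ⟨ P? u ⟩ * f u)

  inside outside : Fin n → ℕ
  inside  v = ∑[ N△[_]? G v ] (△ G)
  outside v = ∑[ N? G v ∩? ∁? (N△? G v) ] (△ G)

  weight : Fin n → Fin n → ℕ
  weight v u = 2 * △ G u + quot (2 * △ G u + 2 * △ G u) (1 ∸ common v u)

  common-pos : ∀ {v u} → Satisfiable (N G u ∩ N G v) → 1 ∸ common v u ≡ 0
  common-pos {v} {u} (w , Euw , Evw) = m≤n⇒m∸n≡0 (subst (_≤ common v u)
    (cong₂ _*_ (⟨⟩-yes (E? v w) Evw) (⟨⟩-yes (E? u w) Euw)) (term≤sum (λ w → e v w * e u w) w))

  common-zero : ∀ {v u} → ¬ Satisfiable (N G u ∩ N G v) → common v u ≡ 0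
  common-zero {v} {u} none = trans (sum-cong-≗ zero-term) (sum-replicate-zero n)
    where
    zero-term : ∀ w → e v w * e u w ≡ 0
    zero-term w with E? v w | E? u w
    ... | yes Evw | yes Euw = contradiction (w , Euw , Evw) none
    ... | yes _   | no _    = refl
    ... | no _    | _       = refl

  weight-split : ∀ v u → e v u * weight v u ≡
    2 * (⟨ N△? G v u ⟩ * △ G u) + 6 * (⟨ (N? G v ∩? ∁? (N△? G v)) u ⟩ * △ G u)
  weight-split v u = split (E? v u) (Fin.any? (N? G u ∩? N? G v))
    where
    open ≡-Reasoning
    split : ∀ (x : Dec (E v u)) (y : Dec (Satisfiable (N G u ∩ N G v))) → ⟨ x ⟩ * weight v u ≡
      2 * (⟨ x ×-dec y ⟩ * △ G u) + 6 * (⟨ x ×-dec ¬? (x ×-dec y) ⟩ * △ G u)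
    split (no _)  _       = refl
    split (yes _) (yes s) rewrite common-pos s = inner (△ G u)
      where
      inner : ∀ t → 2 * t + 0 + 0 ≡ 2 * (t + 0) + 0
      inner = solve-∀
    split (yes _) (no ¬s) rewrite common-zero ¬s | n/1≡n (2 * △ G u + 2 * △ G u) = outer (△ G u)
      where
      outer : ∀ t → 2 * t + (2 * t + 2 * t) + 0 ≡ 0 + 6 * (t + 0)
      outer = solve-∀

  -- By irreflexivity v is not in its own triangle neighbourhood, so the closed neighbourhood is a
  -- disjoint union.
  inside-sum : ∀ v → inside v ≡ △ G v + sum λ u → ⟨ N△? G v u ⟩ * △ G u
  inside-sum v = begin
    inside v
      ≡⟨ ∑≡ (N△[_]? G v) (△ G) ⟩
    sum (λ u → ⟨ N△[_]? G v u ⟩ * △ G u)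
      ≡⟨ sum-cong-≗ (λ u → trans (cong (_* △ G u) (disjoint u)) (*-distribʳ-+ (△ G u) ⟨ v Fin.≟ u ⟩ _)) ⟩
    sum (λ u → ⟨ v Fin.≟ u ⟩ * △ G u + ⟨ N△? G v u ⟩ * △ G u)
      ≡⟨ ∑-distrib-+ (λ u → ⟨ v Fin.≟ u ⟩ * △ G u) _ ⟩
    sum (λ u → ⟨ v Fin.≟ u ⟩ * △ G u) + sum (λ u → ⟨ N△? G v u ⟩ * △ G u)
      ≡⟨ cong (_+ sum λ u → ⟨ N△? G v u ⟩ * △ G u) (sum-delta v (△ G)) ⟩
    △ G v + sum (λ u → ⟨ N△? G v u ⟩ * △ G u) ∎
    where
    open ≡-Reasoning
    disjoint : ∀ u → ⟨ N△[_]? G v u ⟩ ≡ ⟨ v Fin.≟ u ⟩ + ⟨ N△? G v u ⟩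
    disjoint u = go (v Fin.≟ u)
      where
      go : (x : Dec (v ≡ u)) → ⟨ x ⊎-dec N△? G v u ⟩ ≡ ⟨ x ⟩ + ⟨ N△? G v u ⟩
      go (yes refl) = sym (cong suc (⟨⟩-no (N△? G v v) λ N△v → irrefl refl (proj₁ N△v)))
      go (no _)     = refl

  numerator : ∀ v → 2 * △ G v + sum (λ u → e v u * weight v u) ≡ 2 * (inside v + 3 * outside v)
  numerator v = begin
    2 * △ G v + sum (λ u → e v u * weight v u)
      ≡⟨ cong (λ x → 2 * △ G v + x) (trans (sum-cong-≗ (weight-split v)) (trans
           (∑-distrib-+ (λ u → 2 * (⟨ N△? G v u ⟩ * △ G u)) _)
           (cong₂ _+_ (sym (*-distribˡ-sum 2 λ u → ⟨ N△? G v u ⟩ * △ G u))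
                      (trans (sym (*-distribˡ-sum 6 λ u → ⟨ (N? G v ∩? ∁? (N△? G v)) u ⟩ * △ G u)) (cong (6 *_) (sym (∑≡ (N? G v ∩? ∁? (N△? G v)) (△ G)))))))) ⟩
    2 * △ G v + (2 * sum (λ u → ⟨ N△? G v u ⟩ * △ G u) + 6 * outside v)
      ≡⟨ regroup (△ G v) (sum λ u → ⟨ N△? G v u ⟩ * △ G u) (outside v) ⟩
    2 * (△ G v + sum (λ u → ⟨ N△? G v u ⟩ * △ G u) + 3 * outside v)
      ≡⟨ cong (λ x → 2 * (x + 3 * outside v)) (sym (inside-sum v)) ⟩
    2 * (inside v + 3 * outside v) ∎
    where
    open ≡-Reasoning
    regroup : ∀ a b c → 2 * a + (2 * b + 6 * c) ≡ 2 * (a + b + 3 * c)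
    regroup = solve-∀

  isolated : ∀ v (f : Fin n → ℕ) → degree v ≡ 0 → sum (λ u → e v u * f u) ≡ 0
  isolated v f d≡0 = trans (sum-cong-≗ λ u → cong (_* f u) (n≤0⇒n≡0 (subst (e v u ≤_) d≡0 (term≤sum (e v) u))))
    (sum-replicate-zero n)

  isolated-numerator : ∀ v → degree v ≡ 0 → 2 * △ G v + sum (λ u → e v u * weight v u) ≡ 0
  isolated-numerator v d≡0 = cong₂ _+_ (trans (sym (△-common v)) (isolated v (common v) d≡0)) (isolated v (weight v) d≡0)

-- Number of processors and final assembly

-- The bound of `minDegrees-bound` for total degree 2m and threshold `root (m + m)`.
processors : ℕ → ℕ → ℕ
processors _ m = 2 * ((m + m) * root (m + m))

-- The squared form of p ≤ 12 m √m. With L = 2m the square is at most 4 L² · 4 L = 128 m³, and 144 =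
-- 12² is the next square.
processors-bound : ∀ n m → processors n m ^ 2 ≤ 12 ^ 2 * m ^ 3
processors-bound _ m = begin
  (2 * (L * root L)) ^ 2               ≡⟨ square L (root L) ⟩
  4 * (L * L) * (root L * root L)      ≤⟨ *-monoʳ-≤ (4 * (L * L)) (proj₂ (root-bounds L)) ⟩
  4 * (L * L) * (4 * L)                ≤⟨ m≤m+n _ (16 * m ^ 3) ⟩
  4 * (L * L) * (4 * L) + 16 * m ^ 3   ≡⟨ cube m ⟩
  12 ^ 2 * m ^ 3                       ∎
  where
  open ≤-Reasoning
  L : ℕ
  L = m + m
  square : ∀ L r → (2 * (L * r)) * ((2 * (L * r)) * 1) ≡ 4 * (L * L) * (r * r)
  square = solve-∀
  cube : ∀ m → 4 * ((m + m) * (m + m)) * (4 * (m + m)) + 16 * (m * (m * (m * 1))) ≡ 144 * (m * (m * (m * 1)))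
  cube = solve-∀

two-vertices : ∀ {n} {u v : Fin n} → u ≢ v → 2 ≤ n
two-vertices {suc zero}    {zero} {zero} u≢v = contradiction refl u≢v
two-vertices {suc (suc n)} _ = s≤s (s≤s z≤n)

module Run {n : ℕ} (G : Graph n) .{{nz : NonZero (△G G)}} (𝓛 : AdjacencyLists G) where
  open Graph G using (E; irrefl)
  open AdjacencyLists 𝓛 using () renaming (adj to neighbours)
  open Layout G 𝓛
  open Quantities L off tgt src adj
  open Counting G
  open Bounds G
  open Centrality G

  -- As ℓ ≥ 1, n < 2 ^ (1 + ℓ) ≤ 2 ^ (2 ℓ). The exponent 6 ℓ therefore covers n³, which bounds the
  -- number of tests, the longest array scanned.
  p ℓ b : ℕ
  p = processors n (∣E∣ G)
  ℓ = ⌊log₂ n ⌋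
  b = 6 * ℓ

  -- Without arcs the total 6 △(G) would be an empty sum. An arc provides a processor and two
  -- vertices, hence ℓ ≥ 1, which absorbs the additive constant: 88 + 38 · 6 = 316.
  0<L : 0 < L
  0<L = n≢0⇒n>0 λ L≡0 → ≢-nonZero⁻¹ (△G G)
    (m+n≡0⇒m≡0 (△G G) (trans (sym total-△) (cong (prefix c) L≡0)))

  2≤n : 2 ≤ n
  2≤n = let v , k , _ = arcAt-surjective 0<L in two-vertices λ v≡u → irrefl v≡u (lookup-E v k)

  1≤ℓ : 1 ≤ ℓ
  1≤ℓ = ⌊log₂⌋-mono-≤ 2≤n

  1≤n : 1 ≤ n
  1≤n = <⇒≤ 2≤n

  n³≤2^b : n * (n * n) ≤ 2 ^ b
  n³≤2^b = begin
    n * (n * n)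
      ≤⟨ *-mono-≤ n≤ (*-mono-≤ n≤ n≤) ⟩
    2 ^ (2 * ℓ) * (2 ^ (2 * ℓ) * 2 ^ (2 * ℓ))
      ≡⟨ cong (2 ^ (2 * ℓ) *_) (sym (^-distribˡ-+-* 2 (2 * ℓ) (2 * ℓ))) ⟩
    2 ^ (2 * ℓ) * 2 ^ (2 * ℓ + 2 * ℓ)
      ≡⟨ sym (^-distribˡ-+-* 2 (2 * ℓ) (2 * ℓ + 2 * ℓ)) ⟩
    2 ^ (2 * ℓ + (2 * ℓ + 2 * ℓ))
      ≡⟨ cong (2 ^_) (sextuple ℓ) ⟩
    2 ^ b ∎
    where
    open ≤-Reasoning
    sextuple : ∀ ℓ → 2 * ℓ + (2 * ℓ + 2 * ℓ) ≡ 6 * ℓ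
    sextuple = solve-∀
    n≤ : n ≤ 2 ^ (2 * ℓ)
    n≤ = ≤-trans (<⇒≤ (n<2^1+log n)) (^-monoʳ-≤ 2 (+-mono-≤ 1≤ℓ (m≤m+n ℓ 0)))

  n²≤2^b : n * n ≤ 2 ^ b
  n²≤2^b = ≤-trans (≤-trans (≤-reflexive (sym (*-identityˡ (n * n)))) (*-monoˡ-≤ (n * n) 1≤n)) n³≤2^b

  n≤2^b : n ≤ 2 ^ b
  n≤2^b = ≤-trans (≤-trans (≤-reflexive (sym (*-identityˡ n))) (*-monoˡ-≤ n 1≤n)) n²≤2^b

  L≤2^b : L ≤ 2 ^ b
  L≤2^b = ≤-trans (subst (_≤ n * n) handshake (sum-const-≤ degree≤n)) n²≤2^b

  W≤2^b : prefix d L ≤ 2 ^ b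
  W≤2^b = ≤-trans (≤-reflexive W-sum) (≤-trans minDegrees≤n³ n³≤2^b)

  0<root : 0 < root L
  0<root = n≢0⇒n>0 λ r≡0 → <⇒≱ 0<L (subst (λ r → L ≤ r * r) r≡0 (proj₁ (root-bounds L)))

  L≤p : L ≤ p
  L≤p = ≤-trans (m≤m*n L (root L) {{>-nonZero 0<root}}) (m≤m+n _ _)

  W≤p : prefix d L ≤ p
  W≤p = ≤-trans (≤-reflexive W-sum) (subst (λ k → minDegrees ≤ 2 * (k * root L)) handshake
    (minDegrees-bound (root L) 0<root (subst (_≤ root L * root L) (sym handshake) (proj₁ (root-bounds L)))))

  open Correctness {b = b} arcs n≤2^b L≤2^b W≤2^b L≤p W≤p (fromℕ< (<-≤-trans 0<L L≤p))

  duration≤ : duration ≤ 316 * ℓ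
  duration≤ = begin
    duration                ≡⟨ total b ⟩
    88 + 38 * b             ≤⟨ +-monoˡ-≤ (38 * b) (*-monoʳ-≤ 88 1≤ℓ) ⟩
    88 * ℓ + 38 * (6 * ℓ)   ≡⟨ collect ℓ ⟩
    316 * ℓ                 ∎
    where
    open ≤-Reasoning
    total : ∀ b → (6 + ((1 + b * 4) + (2 + ((1 + (5 + b * 5)) + (10 + (1 + b * 4)))))) + ((2 + (5 + (4 + b * 5))) +
      ((4 + ((1 + (5 + b * 5)) + (6 + (4 + b * 5)))) + ((7 + (4 + b * 5)) + ((5 + (4 + b * 5)) + 11)))) ≡ 88 + 38 * b
    total = solve-∀
    collect : ∀ ℓ → 88 * ℓ + 38 * (6 * ℓ) ≡ 316 * ℓ
    collect = solve-∀

  centrality : ∀ v x y → x * (6 * △G G) ≡ (2 * △ G v + sum λ u → e v u * weight v u) * suc y → mkℚᵘ (int x) y ≃ TC G v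
  centrality v x y eq = ratio x y (inside v) (outside v) (△G G)
    (*-cancelˡ-≡ (x * (3 * △G G)) ((inside v + 3 * outside v) * suc y) 2 (begin
      2 * (x * (3 * △G G))                             ≡⟨ pull x (△G G) ⟩
      x * (6 * △G G)                                   ≡⟨ eq ⟩
      (2 * △ G v + sum λ u → e v u * weight v u) * suc y ≡⟨ cong (_* suc y) (numerator v) ⟩
      2 * (inside v + 3 * outside v) * suc y           ≡⟨ *-assoc 2 (inside v + 3 * outside v) (suc y) ⟩
      2 * ((inside v + 3 * outside v) * suc y)         ∎))
    where
    open ≡-Reasoning
    pull : ∀ x g → 2 * (x * (3 * g)) ≡ x * (6 * g)
    pull = solve-∀

  reported-centrality : ∀ ρ M → Reported ρ M → HoldsTC G M
  reported-centrality ρ M rep v with off (suc (toℕ v)) ≤? off (toℕ v) | rep (Fin.toℕ<n v)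
  ... | no off< | nonisolated , _ = centrality v (M 3 (toℕ v)) (M 4 (toℕ v)) (cong₂ _*_
    (trans (proj₁ (nonisolated (≰⇒> off<))) (num-△ v))
    -- Adding 1 to the stored value restores 6 △(G), because △(G) ≥ 1.
    (sym (trans (cong suc (trans (proj₂ (nonisolated (≰⇒> off<))) (cong (_∸ 1) total-△)))
      (m+[n∸m]≡n {1} (≤-trans (>-nonZero⁻¹ (△G G)) (m≤m+n (△G G) _))))))
  ... | yes off≥ | _ , zero-output = centrality v (M 3 (toℕ v)) (M 4 (toℕ v)) (trans
    (cong (_* (6 * △G G)) (proj₁ (zero-output off≥)))
    (sym (cong (_* suc (M 4 (toℕ v))) (isolated-numerator v (trans (sym (deg≡ v)) (m≤n⇒m∸n≡0 off≥))))))

  exec-run : Exec triangleCentrality duration (λ (i : Fin p) → initialRegisters (toℕ i)) (input G 𝓛) Reported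
  exec-run = exec-triangleCentrality refl refl (λ _ → refl) (λ _ → refl) (λ _ _ → refl)

  exec-TC : Exec triangleCentrality (316 * ℓ) (λ (i : Fin p) → initialRegisters (toℕ i)) (input G 𝓛) (λ _ → HoldsTC G)
  exec-TC = exec-weaken duration≤ reported-centrality exec-run

  computes : ∃[ t ] (t ≤ 316 * ℓ × CREW-Computes triangleCentrality p t (input G 𝓛) (HoldsTC G))
  computes = exec-computes exec-TC (λ _ _ h → h)

theorem4 : Σ[ P ∈ Program ] Σ[ procs ∈ (ℕ → ℕ → ℕ) ] Σ[ C ∈ ℕ ] Σ[ D ∈ ℕ ]
    (∀ (n : ℕ) (G : Graph n) .{{_ : NonZero (△G G)}} (L : AdjacencyLists G) →
    procs n (∣E∣ G) ^ 2 ≤ C ^ 2 * ∣E∣ G ^ 3 ×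
    (∃[ t ] (t ≤ D * ⌊log₂ n ⌋ ×
    CREW-Computes P (procs n (∣E∣ G)) t (input G L) (HoldsTC G))))
theorem4 = triangleCentrality , processors , 12 , 316 , λ n G 𝓛 →
  processors-bound n (∣E∣ G) , Run.computes G 𝓛
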